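{- Let $r\ge 3$ be an integer and let $n$ be sufficiently large. Suppose $H$ is a $4$-uniform hypergraph on $n$ vertices with at least $\left(\frac{r-2}{r-1}-10^{ -33}r^{ -70}\right)\binom{n}{4}$ edges which contains no copy of ${\cal C}^{(4)}_r$. Then $r=2^p+1$ for some integer $p\ge 1$.
   Context: ${\cal C}^{(4)}_r$ is the $4$-uniform hypergraph obtained by taking pairwise disjoint sets $P_1,\dots,P_r$ each of size $2$ and taking as edges all sets $P_i\cup P_j$ with $i\neq j$. -}

module Defs where

open import Data.Fin using (Fin)
open import Data.Fin.Subset using (Subset; ∣_∣; _∩_; _∪_; Empty)
open import Data.Integer using (+_)
open import Data.List using (List; length)
open import Data.List.Membership.Propositional using (_∈_)
open import Data.List.Relation.Unary.All using (All)
open import Data.List.Relation.Unary.Unique.Propositional using (Unique)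
open import Data.Nat using (ℕ; _∸_; _*_; _^_; _≤_; NonZero; s≤s; z≤n; >-nonZero)
open import Data.Nat.Properties using (≤-trans; m<n⇒0<n∸m; m*n≢0; m^n≢0)
open import Data.Rational.Unnormalised using (ℚᵘ; _/_; _-_)
open import Relation.Binary.PropositionalEquality using (_≡_; _≢_)

-- The vertex set is Fin n; the edge set is a duplicate-free list of k-subsets.
record UniformHypergraph (k n : ℕ) : Set where
  field
    edges   : List (Subset n)
    unique  : Unique edges
    uniform : All (λ e → ∣ e ∣ ≡ k) edges

  edgeCount : ℕ
  edgeCount = length edges

open UniformHypergraph public

-- A (not necessarily induced) copy of C⁽⁴⁾ᵣ in H.
record CopyOfC⁽⁴⁾ (r : ℕ) {n : ℕ} (H : UniformHypergraph 4 n) : Set where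
  field
    P        : Fin r → Subset n
    size     : ∀ i → ∣ P i ∣ ≡ 2
    disjoint : ∀ i j → i ≢ j → Empty (P i ∩ P j)
    present  : ∀ i j → i ≢ j → P i ∪ P j ∈ edges H

-- (r - 2)/(r - 1) - 10⁻³³ r⁻⁷⁰.  The hypothesis on r makes the denominators
-- nonzero and the truncated subtractions exact.
densityBound : (r : ℕ) → 3 ≤ r → ℚᵘ
densityBound r 3≤r = + (r ∸ 2) / (r ∸ 1) - + 1 / (r ^ 70 * 10 ^ 33)
  where
  instance
    r≢0 : NonZero r
    r≢0 = >-nonZero (≤-trans (s≤s z≤n) 3≤r)

    r∸1≢0 : NonZero (r ∸ 1)
    r∸1≢0 = >-nonZero (m<n⇒0<n∸m (≤-trans (s≤s (s≤s z≤n)) 3≤r))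

    denominator≢0 : NonZero (r ^ 70 * 10 ^ 33)
    denominator≢0 = m*n≢0 (r ^ 70) (10 ^ 33) {{m^n≢0 r 70}} {{_}}

{-# OPTIONS --safe #-}
-- Call two pairs of vertices adjacent when their union is an edge of H, so that a copy of C⁽⁴⁾ᵣ is
-- a clique of size r. Füredi's argument partitions the pairs into s = r - 1 colour classes so that
-- adjacency almost coincides with having different colours. Since an edge abcd is split into pairs
-- in three ways, almost all 4-tuples satisfy: ab and cd have the same colour iff ac and bd do.
-- Consequently the colour of ac is almost determined by those of ab and bc, and this composition
-- of colours is commutative, associative and satisfies i(ij) = j: the colours form an elementary
-- abelian 2-group. That every composable triple of colours occurs on a path follows from a
-- second-moment bound showing that at almost every vertex the colours are equidistributed.
module Submission where

open import Defs
open import Data.Integer using (+_)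
open import Data.Nat using (ℕ; _+_; _^_; _≤_)
open import Data.Nat.Combinatorics using (_C_)
open import Data.Product using (∃-syntax; _×_)
open import Data.Rational.Unnormalised using (_/_; _*_) renaming (_≤_ to _≤ℚ_)
open import Relation.Binary.PropositionalEquality using (_≡_)
open import Relation.Nullary using (¬_)
import Data.Bool as Bool
open import Data.Bool using (Bool; true; false; not; _∧_; _xor_; if_then_else_; T)
open import Data.Bool.Properties using (T?)
open import Data.Empty using (⊥-elim)
open import Data.Fin as Fin using (Fin; zero; suc; _≟_)
open import Data.Fin.Properties using (injective⇒≤; any?)
open import Data.Fin.Subset using (Subset; inside; outside; ⊥; ⁅_⁆; _∪_; _∩_; ∣_∣; Empty) renaming (_-_ to _∖_)
open import Data.Fin.Subset.Properties using (∣⁅x⁆∣≡1; ∪-assoc; ∪-identityʳ; ∪-identityˡ; ∪-comm; x∈p⇒∣p-x∣<∣p∣; p─⊥≡p)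
open import Data.Integer using (ℤ; -[1+_]; 0ℤ; 1ℤ; -1ℤ; _-_; +≤+; +<+; positive; nonNegative) renaming (_+_ to _⊕_; _*_ to _⊗_; -_ to ⊖_; _^_ to _^ℤ_; _≤_ to _≤ᶻ_; _<_ to _<ᶻ_)
open import Data.Integer.Properties using (≤-refl; ≤-reflexive; ≤-trans; ≤-totalOrder; _≤?_; ≰⇒>; <⇒≤; <⇒≱; <-≤-trans; ≤-<-trans; <-irrefl; +-mono-≤; +-identityˡ; +-identityʳ; *-zeroʳ; *-zeroˡ; *-identityˡ; *-identityʳ; *-distribˡ-+; *-comm; *-assoc; *-monoˡ-≤-nonNeg; *-monoˡ-<-pos; *-monoʳ-<-pos; *-cancelˡ-≤-pos; *-cancelˡ-<-nonNeg; i≤j⇒0≤j-i; 0≤i-j⇒j≤i; pos-*; module ≤-Reasoning)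
open import Data.Integer.Tactic.RingSolver using (solve-∀)
open import Data.List as List using (List; []; _∷_; length; filterᵇ; cartesianProduct; map; _++_; allFin)
open import Data.List.Extrema ≤-totalOrder using (argmax; f[xs]≤f[argmax]; argmax-all)
open import Data.List.Membership.Propositional using (_∈_; _∉_)
open import Data.List.Membership.Propositional.Properties using (∈-lookup; ∈-map⁺; ∈-map⁻; ∈-++⁺ˡ; ∈-++⁺ʳ; ∈-++⁻; ∈-filter⁺; ∈-filter⁻; ∈-allFin)
import Data.List.Membership.DecPropositional as DecMembership
import Data.List.Membership.Setoid.Properties as SetoidMembership
open import Data.List.Properties using (length-++; length-map; length-tabulate; map-tabulate)
open import Data.List.Relation.Unary.All as All using ([]; _∷_)
import Data.List.Relation.Unary.All.Properties as All
open import Data.List.Relation.Unary.AllPairs using ([]; _∷_)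
open import Data.List.Relation.Unary.Any using (here; there)
open import Data.List.Relation.Unary.Unique.Propositional using (Unique)
open import Data.List.Relation.Unary.Unique.Propositional.Properties using (map⁺; ++⁺)
open import Data.Nat as ℕ using (z≤n; s≤s; NonZero; _∸_; _!)
open import Data.Nat.Combinatorics using (nCk+nC[k+1]≡[n+1]C[k+1]; nC1≡n)
import Data.Nat.Properties as ℕ
open import Data.Product using (Σ-syntax; _,_; proj₁; proj₂)
import Data.Rational.Unnormalised as ℚ
open import Data.Rational.Unnormalised.Properties using (drop-*≤*)
open import Data.Sum using (inj₁; inj₂)
open import Data.Unit using (⊤; tt)
open import Data.Vec as Vec using ([]; _∷_)
open import Data.Vec.Properties using (≡-dec)
open import Function using (_∘_; id)
open import Relation.Binary.Definitions using (DecidableEquality)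
open import Relation.Binary.PropositionalEquality using (_≢_; refl; sym; trans; cong; cong₂; subst; subst₂; setoid; module ≡-Reasoning)
open import Relation.Nullary using (yes; no; does; contradiction; ¬?)
open import Relation.Nullary.Decidable using (decidable-stable)

-- Finite sums of integers

-- All counts run over ordered tuples of vertices, repetitions allowed. Two pairs whose union is an
-- edge are proper and disjoint, so degenerate tuples are never adjacent, while sums over all tuples
-- factor. Rationals are cleared by an integer `E`, the reciprocal of the permitted loss of density.
-- The obstacle is that composition must be defined for every two colours, so paths of each colour
-- pattern have to outnumber the exceptional tuples. Let `w a` be the vector of deviations of the
-- colour degrees at `a` from their mean. Few bad tuples make the inner products of `w a` and `w d`
-- small in mean square, and many almost orthogonal vectors in a space of dimension `s` are mostly
-- short. Composition is single-valued because two triangles that agree in two colours but not in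
-- the third always produce a bad tuple. Bad tuples have proportion at most `12/E`, paths of a given
-- pattern at least `1/(8s³)`. A triangle pattern is accepted from proportion `1/K` on, `K = 64s⁶`,
-- and single-valuedness then asks for `E > 36K² = 147456s¹²`.

private variable
  A A′ : Set

≤-by-difference : ∀ {x y t} → 0ℤ ≤ᶻ t → y - x ≡ t → x ≤ᶻ y
≤-by-difference {x} {y} 0≤t eq = 0≤i-j⇒j≤i {y} {x} (≤-trans 0≤t (≤-reflexive (sym eq)))

0≤-* : ∀ {x y} → 0ℤ ≤ᶻ x → 0ℤ ≤ᶻ y → 0ℤ ≤ᶻ x ⊗ y
0≤-* {x} {y} 0≤x 0≤y = ≤-trans (≤-reflexive (sym (*-zeroʳ x))) (*-monoˡ-≤-nonNeg x {{nonNegative 0≤x}} 0≤y)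

0≤-+ : ∀ {x y} → 0ℤ ≤ᶻ x → 0ℤ ≤ᶻ y → 0ℤ ≤ᶻ x ⊕ y
0≤-+ = +-mono-≤

*-monoˡ : ∀ {k x y} → 0ℤ ≤ᶻ k → x ≤ᶻ y → k ⊗ x ≤ᶻ k ⊗ y
*-monoˡ {k} 0≤k = *-monoˡ-≤-nonNeg k {{nonNegative 0≤k}}

*-mono : ∀ {w x y z} → 0ℤ ≤ᶻ w → 0ℤ ≤ᶻ y → w ≤ᶻ x → y ≤ᶻ z → w ⊗ y ≤ᶻ x ⊗ z
*-mono {w} {x} {y} {z} 0≤w 0≤y w≤x y≤z =
  ≤-trans (*-monoˡ 0≤w y≤z) (≤-trans (≤-reflexive (*-comm w z)) (≤-trans (*-monoˡ (≤-trans 0≤y y≤z) w≤x) (≤-reflexive (*-comm z x))))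

0≤x² : ∀ x → 0ℤ ≤ᶻ x ⊗ x
0≤x² (+ n) = 0≤-* {+ n} (+≤+ z≤n) (+≤+ z≤n)
0≤x² -[1+ n ] = +≤+ z≤n

0≤+ : ∀ {n} → 0ℤ ≤ᶻ + n
0≤+ = +≤+ z≤n

²-cancel-≤ : ∀ {x y} → 0ℤ ≤ᶻ y → x ⊗ x ≤ᶻ y ⊗ y → x ≤ᶻ y
²-cancel-≤ {x} {y} 0≤y x²≤y² with x ≤? y
... | yes x≤y = x≤y
... | no  x≰y = contradiction x²≤y² (<⇒≱ (≤-<-trans (*-monoˡ 0≤y (<⇒≤ y<x)) y*x<x*x))
  where
  y<x = ≰⇒> x≰y
  y*x<x*x : y ⊗ x <ᶻ x ⊗ x
  y*x<x*x = *-monoʳ-<-pos x {{positive (≤-<-trans 0≤y y<x)}} y<x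

positive-* : ∀ {x y} → 0ℤ <ᶻ x → 0ℤ <ᶻ y → 0ℤ <ᶻ x ⊗ y
positive-* {x} {y} 0<x 0<y = ≤-<-trans (≤-reflexive (sym (*-zeroʳ x))) (*-monoˡ-<-pos x {{positive 0<x}} 0<y)

⟦_⟧ : Bool → ℤ
⟦ true ⟧  = 1ℤ
⟦ false ⟧ = 0ℤ

0≤⟦⟧ : ∀ b → 0ℤ ≤ᶻ ⟦ b ⟧
0≤⟦⟧ true  = 0≤+
0≤⟦⟧ false = 0≤+

⟦⟧≤1 : ∀ b → ⟦ b ⟧ ≤ᶻ 1ℤ
⟦⟧≤1 true  = ≤-refl
⟦⟧≤1 false = 0≤+

∑ : List A → (A → ℤ) → ℤ
∑ []       f = 0ℤ
∑ (x ∷ xs) f = f x ⊕ ∑ xs f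

infix 5 ∑
syntax ∑ xs (λ x → e) = ∑[ x ∈ xs ] e

∑-cong : ∀ (xs : List A) {f g} → (∀ x → f x ≡ g x) → ∑ xs f ≡ ∑ xs g
∑-cong []       f≡g = refl
∑-cong (x ∷ xs) f≡g = cong₂ _⊕_ (f≡g x) (∑-cong xs f≡g)

∑-mono-∈ : ∀ (xs : List A) {f g} → (∀ {x} → x ∈ xs → f x ≤ᶻ g x) → ∑ xs f ≤ᶻ ∑ xs g
∑-mono-∈ []       f≤g = ≤-refl
∑-mono-∈ (x ∷ xs) f≤g = +-mono-≤ (f≤g (here refl)) (∑-mono-∈ xs (f≤g ∘ there))

∑-mono : ∀ (xs : List A) {f g} → (∀ x → f x ≤ᶻ g x) → ∑ xs f ≤ᶻ ∑ xs g
∑-mono xs f≤g = ∑-mono-∈ xs (λ {x} _ → f≤g x)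

∑-zero : ∀ (xs : List A) → ∑ xs (λ _ → 0ℤ) ≡ 0ℤ
∑-zero []       = refl
∑-zero (x ∷ xs) = trans (+-identityˡ _) (∑-zero xs)

∑-nonneg : ∀ (xs : List A) {f} → (∀ x → 0ℤ ≤ᶻ f x) → 0ℤ ≤ᶻ ∑ xs f
∑-nonneg []       0≤f = ≤-refl
∑-nonneg (x ∷ xs) 0≤f = 0≤-+ (0≤f x) (∑-nonneg xs 0≤f)

∑-+ : ∀ (xs : List A) f g → ∑[ x ∈ xs ] (f x ⊕ g x) ≡ ∑ xs f ⊕ ∑ xs g
∑-+ []       f g = refl
∑-+ (x ∷ xs) f g = trans (cong (f x ⊕ g x ⊕_) (∑-+ xs f g)) (interchange (f x) (g x) (∑ xs f) (∑ xs g))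
  where
  interchange : ∀ a b c d → (a ⊕ b) ⊕ (c ⊕ d) ≡ (a ⊕ c) ⊕ (b ⊕ d)
  interchange = solve-∀

∑-*ˡ : ∀ (xs : List A) k f → ∑[ x ∈ xs ] (k ⊗ f x) ≡ k ⊗ ∑ xs f
∑-*ˡ []       k f = sym (*-zeroʳ k)
∑-*ˡ (x ∷ xs) k f = trans (cong (k ⊗ f x ⊕_) (∑-*ˡ xs k f)) (sym (*-distribˡ-+ k (f x) (∑ xs f)))

∑-*ʳ : ∀ (xs : List A) k f → ∑[ x ∈ xs ] (f x ⊗ k) ≡ ∑ xs f ⊗ k
∑-*ʳ xs k f = trans (∑-cong xs (λ x → *-comm (f x) k)) (trans (∑-*ˡ xs k f) (*-comm k _))

∑-- : ∀ (xs : List A) f g → ∑[ x ∈ xs ] (f x - g x) ≡ ∑ xs f - ∑ xs g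
∑-- []       f g = refl
∑-- (x ∷ xs) f g = trans (cong (f x - g x ⊕_) (∑-- xs f g)) (interchange (f x) (g x) (∑ xs f) (∑ xs g))
  where
  interchange : ∀ a b c d → (a - b) ⊕ (c - d) ≡ (a ⊕ c) - (b ⊕ d)
  interchange = solve-∀

∑-const : ∀ (xs : List A) k → ∑[ x ∈ xs ] k ≡ + length xs ⊗ k
∑-const []       k = sym (*-zeroˡ k)
∑-const (x ∷ xs) k = trans (cong (k ⊕_) (∑-const xs k)) (lemma k (+ length xs))
  where
  lemma : ∀ k l → k ⊕ l ⊗ k ≡ (1ℤ ⊕ l) ⊗ k
  lemma = solve-∀

∑-swap : ∀ (xs : List A) (ys : List A′) (f : A → A′ → ℤ) →
         ∑[ x ∈ xs ] ∑[ y ∈ ys ] f x y ≡ ∑[ y ∈ ys ] ∑[ x ∈ xs ] f x y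
∑-swap []       ys f = sym (∑-zero ys)
∑-swap (x ∷ xs) ys f = trans (cong (∑ ys (f x) ⊕_) (∑-swap xs ys f)) (sym (∑-+ ys (f x) (λ y → ∑[ x ∈ xs ] f x y)))

∑-*-∑ : ∀ (xs : List A) (ys : List A′) (f : A → ℤ) (g : A′ → ℤ) →
        ∑ xs f ⊗ ∑ ys g ≡ ∑[ x ∈ xs ] ∑[ y ∈ ys ] (f x ⊗ g y)
∑-*-∑ xs ys f g = sym (trans (∑-cong xs (λ x → ∑-*ˡ ys (f x) g)) (∑-*ʳ xs (∑ ys g) f))

∑-++ : ∀ (xs ys : List A) f → ∑ (xs ++ ys) f ≡ ∑ xs f ⊕ ∑ ys f
∑-++ []       ys f = sym (+-identityˡ _)
∑-++ (x ∷ xs) ys f = trans (cong (f x ⊕_) (∑-++ xs ys f)) (assoc (f x) (∑ xs f) (∑ ys f))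
  where
  assoc : ∀ a b c → a ⊕ (b ⊕ c) ≡ (a ⊕ b) ⊕ c
  assoc = solve-∀

∑-map : ∀ (xs : List A) (h : A → A′) f → ∑ (map h xs) f ≡ ∑ xs (f ∘ h)
∑-map []       h f = refl
∑-map (x ∷ xs) h f = cong (f (h x) ⊕_) (∑-map xs h f)

∑-cartesianProduct : ∀ (xs : List A) (ys : List A′) f →
  ∑ (cartesianProduct xs ys) f ≡ ∑[ x ∈ xs ] ∑[ y ∈ ys ] f (x , y)
∑-cartesianProduct []       ys f = refl
∑-cartesianProduct (x ∷ xs) ys f =
  trans (∑-++ (map (x ,_) ys) (cartesianProduct xs ys) f)
        (cong₂ _⊕_ (∑-map ys (x ,_) f) (∑-cartesianProduct xs ys f))

∑-filter : ∀ (p : A → Bool) xs f → ∑ (filterᵇ p xs) f ≡ ∑[ x ∈ xs ] (⟦ p x ⟧ ⊗ f x)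
∑-filter p []       f = refl
∑-filter p (x ∷ xs) f with p x
... | true  = cong₂ _⊕_ (sym (*-identityˡ (f x))) (∑-filter p xs f)
... | false = trans (∑-filter p xs f) (trans (sym (+-identityˡ _)) (cong (_⊕ ∑ xs (λ x → ⟦ p x ⟧ ⊗ f x)) (sym (*-zeroˡ (f x)))))

∑-positive⇒∃ : ∀ (xs : List A) {f} → 0ℤ <ᶻ ∑ xs f → ∃[ x ] 0ℤ <ᶻ f x
∑-positive⇒∃ []           0<0 = ⊥-elim (<-irrefl refl 0<0)
∑-positive⇒∃ (x ∷ xs) {f} 0<∑ with f x ≤? 0ℤ
... | no  fx≰0 = x , ≰⇒> fx≰0
... | yes fx≤0 = ∑-positive⇒∃ xs (<-≤-trans 0<∑ (≤-trans (+-mono-≤ fx≤0 (≤-refl {∑ xs f})) (≤-reflexive (+-identityˡ _))))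

term≤∑ : ∀ {xs : List A} {f x} → (∀ x → 0ℤ ≤ᶻ f x) → x ∈ xs → f x ≤ᶻ ∑ xs f
term≤∑ {xs = x ∷ xs} {f} 0≤f (here refl) = ≤-trans (≤-reflexive (sym (+-identityʳ (f x)))) (+-mono-≤ (≤-refl {f x}) (∑-nonneg xs 0≤f))
term≤∑ {xs = x ∷ xs} {f} 0≤f (there x∈)  = ≤-trans (term≤∑ 0≤f x∈) (≤-trans (≤-reflexive (sym (+-identityˡ _))) (+-mono-≤ (0≤f x) ≤-refl))

∑-allFin-suc : ∀ n (f : Fin (ℕ.suc n) → ℤ) → ∑ (allFin (ℕ.suc n)) f ≡ f zero ⊕ ∑ (allFin n) (f ∘ suc)
∑-allFin-suc n f = cong (f zero ⊕_) (trans (cong (λ xs → ∑ xs f) (sym (map-tabulate id suc))) (∑-map (allFin n) suc f))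

∑-const-allFin : ∀ n k → ∑[ x ∈ allFin n ] k ≡ + n ⊗ k
∑-const-allFin n k = trans (∑-const (allFin n) k) (cong (λ l → + l ⊗ k) (length-tabulate {n = n} id))

_==_ : ∀ {n} → Fin n → Fin n → Bool
i == j = does (i ≟ j)

==-refl : ∀ {n} (i : Fin n) → (i == i) ≡ true
==-refl i with i ≟ i
... | yes _   = refl
... | no  i≢i = contradiction refl i≢i

==-sym : ∀ {n} (i j : Fin n) → (i == j) ≡ (j == i)
==-sym i j with i ≟ j | j ≟ i
... | yes _   | yes _   = refl
... | no  _   | no  _   = refl
... | yes i≡j | no  j≢i = contradiction (sym i≡j) j≢i
... | no  i≢j | yes j≡i = contradiction (sym j≡i) i≢j

∑-pick : ∀ {n} (c : Fin n) (f : Fin n → ℤ) → ∑[ i ∈ allFin n ] (⟦ c == i ⟧ ⊗ f i) ≡ f c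
∑-pick {ℕ.suc n} zero f = begin
  ∑[ i ∈ allFin (ℕ.suc n) ] (⟦ zero == i ⟧ ⊗ f i)       ≡⟨ ∑-allFin-suc n (λ i → ⟦ zero == i ⟧ ⊗ f i) ⟩
  1ℤ ⊗ f zero ⊕ (∑[ i ∈ allFin n ] (0ℤ ⊗ f (suc i)))    ≡⟨ cong₂ _⊕_ (*-identityˡ (f zero)) (∑-*ˡ (allFin n) 0ℤ (f ∘ suc)) ⟩
  f zero ⊕ 0ℤ ⊗ ∑ (allFin n) (f ∘ suc)                  ≡⟨ cong (f zero ⊕_) (*-zeroˡ (∑ (allFin n) (f ∘ suc))) ⟩
  f zero ⊕ 0ℤ                                           ≡⟨ +-identityʳ (f zero) ⟩
  f zero                                                ∎
  where open ≡-Reasoning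
∑-pick {ℕ.suc n} (suc c) f = begin
  ∑[ i ∈ allFin (ℕ.suc n) ] (⟦ suc c == i ⟧ ⊗ f i)                 ≡⟨ ∑-allFin-suc n (λ i → ⟦ suc c == i ⟧ ⊗ f i) ⟩
  0ℤ ⊗ f zero ⊕ (∑[ i ∈ allFin n ] (⟦ c == i ⟧ ⊗ f (suc i)))       ≡⟨ cong₂ _⊕_ (*-zeroˡ (f zero)) (∑-pick c (f ∘ suc)) ⟩
  0ℤ ⊕ f (suc c)                                                   ≡⟨ +-identityˡ (f (suc c)) ⟩
  f (suc c)                                                        ∎
  where open ≡-Reasoning

-- Füredi's stability theorem

module _ {W : Set} (adj : W → W → Bool) where

  -- Vertices are picked one by one among the common neighbours of the earlier ones, in step with
  -- the recursion on neighbourhoods in `clique-free⇒colouring`. A loop at a member of `S` yields a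
  -- clique of every size, so the notion fits any symmetric relation.
  HasClique : ℕ → List W → Set
  HasClique ℕ.zero    S = ⊤
  HasClique (ℕ.suc k) S = ∃[ x ] (x ∈ S × HasClique k (filterᵇ (adj x) S))

  -- Twins share a colour. The ordered pairs `(a , b)` and `(b , a)` will be twins, and this makes
  -- the colouring of pairs symmetric.
  Respects : {C : Set} → (W → C) → Set
  Respects col = ∀ x y → (∀ z → adj z x ≡ adj z y) → col x ≡ col y

  monochromatic-adjacent bichromatic : ∀ {k} → (W → Fin k) → W → W → ℤ
  monochromatic-adjacent col x y = ⟦ adj x y ∧ (col x == col y) ⟧
  bichromatic col x y = ⟦ not (col x == col y) ⟧

  degree : List W → W → ℤ
  degree S x = ∑[ y ∈ S ] ⟦ adj x y ⟧

  max-degree : ∀ x₀ S → ∃[ x ] (x ∈ x₀ ∷ S × (∀ {y} → y ∈ x₀ ∷ S → degree (x₀ ∷ S) y ≤ᶻ degree (x₀ ∷ S) x))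
  max-degree x₀ S = argmax deg x₀ S′ , argmax-all deg {P = _∈ S′} (here refl) (All.tabulate (λ y∈ → y∈)) ,
                    All.lookup (f[xs]≤f[argmax] {f = deg} x₀ S′)
    where
    S′ = x₀ ∷ S
    deg = degree S′

  module Recolour (adj-sym : ∀ x y → adj x y ≡ adj y x) {k} (S : List W) (x : W) (col′ : W → Fin (ℕ.suc k)) where
    S′ = filterᵇ (adj x) S

    α : W → Bool
    α = adj x

    col : W → Fin (2 ℕ.+ k)
    col y = if α y then suc (col′ y) else zero

    respects : Respects col′ → Respects col
    respects respects′ y z twins rewrite twins x with adj x z
    ... | true  = cong suc (respects′ y z twins)
    ... | false = refl

    L R : W → W → ℤ
    L y z = ⟦ adj y z ⟧ ⊕ monochromatic-adjacent col y z
    R = bichromatic col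

    L′ R′ : W → W → ℤ
    L′ y z = ⟦ adj y z ⟧ ⊕ monochromatic-adjacent col′ y z
    R′ = bichromatic col′

    -- An edge between two non-neighbours of `x` is monochromatic, both ends having colour `zero`,
    -- and so has weight two in `L`. Summing degrees over the non-neighbours counts it once from
    -- each end: this is the gain over Turán's bound.
    L-split : ∀ y z → L y z ≡ ⟦ α y ⟧ ⊗ (⟦ α z ⟧ ⊗ L′ y z) ⊕ (⟦ not (α y) ⟧ ⊗ ⟦ adj y z ⟧ ⊕ ⟦ not (α z) ⟧ ⊗ ⟦ adj z y ⟧)
    L-split y z rewrite adj-sym z y with adj x y | adj x z
    L-split y z | true | true with adj y z | col′ y == col′ z
    ... | true  | true  = refl
    ... | true  | false = refl
    ... | false | _     = refl
    L-split y z | true | false with adj y z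
    ... | true  = refl
    ... | false = refl
    L-split y z | false | true with adj y z
    ... | true  = refl
    ... | false = refl
    L-split y z | false | false with adj y z
    ... | true  = refl
    ... | false = refl

    R-split : ∀ y z → R y z ≡ ⟦ α y ⟧ ⊗ (⟦ α z ⟧ ⊗ R′ y z) ⊕ (⟦ not (α y) ⟧ ⊗ ⟦ α z ⟧ ⊕ ⟦ not (α z) ⟧ ⊗ ⟦ α y ⟧)
    R-split y z with adj x y | adj x z
    R-split y z | true | true with col′ y == col′ z
    ... | true  = refl
    ... | false = refl
    R-split y z | true  | false = refl
    R-split y z | false | true  = refl
    R-split y z | false | false = refl

    -- The two terms with `H` are transposes of each other, hence the factor 2; the first term lives
    -- on the neighbourhood `S′`.
    ∑-split : ∀ (F G : W → W → ℤ) (H : W → W → ℤ) →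
      (∀ y z → F y z ≡ ⟦ α y ⟧ ⊗ (⟦ α z ⟧ ⊗ G y z) ⊕ (⟦ not (α y) ⟧ ⊗ H y z ⊕ ⟦ not (α z) ⟧ ⊗ H z y)) →
      ∑[ y ∈ S ] ∑[ z ∈ S ] F y z ≡
      (∑[ y ∈ S′ ] ∑[ z ∈ S′ ] G y z) ⊕ + 2 ⊗ (∑[ y ∈ S ] (⟦ not (α y) ⟧ ⊗ ∑ S (H y)))
    ∑-split F G H split = begin
      ∑[ y ∈ S ] ∑[ z ∈ S ] F y z
        ≡⟨ ∑-cong S (λ y → ∑-cong S (split y)) ⟩
      ∑[ y ∈ S ] ∑[ z ∈ S ] (g y z ⊕ (h y z ⊕ h z y))
        ≡⟨ ∑-cong S (λ y → trans (∑-+ S (g y) _) (cong (∑ S (g y) ⊕_) (∑-+ S (h y) (λ z → h z y)))) ⟩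
      ∑[ y ∈ S ] (∑ S (g y) ⊕ (∑ S (h y) ⊕ (∑[ z ∈ S ] h z y)))
        ≡⟨ trans (∑-+ S (λ y → ∑ S (g y)) _) (cong ((∑[ y ∈ S ] ∑ S (g y)) ⊕_) (∑-+ S (λ y → ∑ S (h y)) (λ y → ∑[ z ∈ S ] h z y))) ⟩
      (∑[ y ∈ S ] ∑ S (g y)) ⊕ ((∑[ y ∈ S ] ∑ S (h y)) ⊕ (∑[ y ∈ S ] ∑[ z ∈ S ] h z y))
        ≡⟨ cong₂ _⊕_ to-filter (trans (cong ((∑[ y ∈ S ] ∑ S (h y)) ⊕_) (∑-swap S S (λ y z → h z y))) (double (∑[ y ∈ S ] ∑ S (h y)))) ⟩
      (∑[ y ∈ S′ ] ∑[ z ∈ S′ ] G y z) ⊕ + 2 ⊗ (∑[ y ∈ S ] ∑ S (h y))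
        ≡⟨ cong (λ t → (∑[ y ∈ S′ ] ∑[ z ∈ S′ ] G y z) ⊕ + 2 ⊗ t) (∑-cong S (λ y → ∑-*ˡ S ⟦ not (α y) ⟧ (H y))) ⟩
      (∑[ y ∈ S′ ] ∑[ z ∈ S′ ] G y z) ⊕ + 2 ⊗ (∑[ y ∈ S ] (⟦ not (α y) ⟧ ⊗ ∑ S (H y))) ∎
      where
      open ≡-Reasoning
      g h : W → W → ℤ
      g y z = ⟦ α y ⟧ ⊗ (⟦ α z ⟧ ⊗ G y z)
      h y z = ⟦ not (α y) ⟧ ⊗ H y z
      double : ∀ a → a ⊕ a ≡ + 2 ⊗ a
      double = solve-∀
      to-filter : ∑[ y ∈ S ] ∑ S (g y) ≡ ∑[ y ∈ S′ ] ∑[ z ∈ S′ ] G y z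
      to-filter = sym (trans (∑-filter α S (λ y → ∑ S′ (G y))) (∑-cong S (λ y →
        trans (cong (⟦ α y ⟧ ⊗_) (∑-filter α S (G y))) (sym (∑-*ˡ S ⟦ α y ⟧ (λ z → ⟦ α z ⟧ ⊗ G y z))))))

    bound : (∀ {y} → y ∈ S → degree S y ≤ᶻ degree S x) →
            ∑[ y ∈ S′ ] ∑[ z ∈ S′ ] L′ y z ≤ᶻ ∑[ y ∈ S′ ] ∑[ z ∈ S′ ] R′ y z →
            ∑[ y ∈ S ] ∑[ z ∈ S ] L y z ≤ᶻ ∑[ y ∈ S ] ∑[ z ∈ S ] R y z
    bound maximal bound′ = begin
      ∑[ y ∈ S ] ∑[ z ∈ S ] L y z
        ≡⟨ ∑-split L L′ (λ y z → ⟦ adj y z ⟧) L-split ⟩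
      (∑[ y ∈ S′ ] ∑[ z ∈ S′ ] L′ y z) ⊕ + 2 ⊗ (∑[ y ∈ S ] (⟦ not (α y) ⟧ ⊗ degree S y))
        ≤⟨ +-mono-≤ bound′ (*-monoˡ (0≤+ {2}) (∑-mono-∈ S (λ {y} y∈ →
             *-monoˡ (0≤⟦⟧ (not (α y))) (maximal y∈)))) ⟩
      (∑[ y ∈ S′ ] ∑[ z ∈ S′ ] R′ y z) ⊕ + 2 ⊗ (∑[ y ∈ S ] (⟦ not (α y) ⟧ ⊗ degree S x))
        -- The sum of `⟦ α z ⟧` over `z` is the degree of `x`: a non-neighbour of `x` differs in
        -- colour from exactly the neighbours of `x`.
        ≡⟨ sym (∑-split R R′ (λ y z → ⟦ α z ⟧) R-split) ⟩
      ∑[ y ∈ S ] ∑[ z ∈ S ] R y z ∎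
      where open ≤-Reasoning

  -- Füredi's proof of the stability theorem: x has maximum degree, its non-neighbours form
  -- a colour class, and the graph induced on its neighbours is coloured recursively.
  clique-free⇒colouring : (∀ x y → adj x y ≡ adj y x) → ∀ k S → ¬ HasClique (2 ℕ.+ k) S →
    Σ[ col ∈ (W → Fin (ℕ.suc k)) ]
      (Respects col ×
       ∑[ x ∈ S ] ∑[ y ∈ S ] (⟦ adj x y ⟧ ⊕ monochromatic-adjacent col x y) ≤ᶻ
       ∑[ x ∈ S ] ∑[ y ∈ S ] bichromatic col x y)
  clique-free⇒colouring adj-sym k [] _ = (λ _ → zero) , (λ _ _ _ → refl) , ≤-refl
  clique-free⇒colouring adj-sym ℕ.zero S@(_ ∷ _) noK₂ =
    (λ _ → zero) , (λ _ _ _ → refl) , ∑-mono-∈ S (λ {x} x∈ → ∑-mono-∈ S (λ {y} y∈ → edgeless x y x∈ y∈))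
    where
    edgeless : ∀ x y → x ∈ S → y ∈ S → ⟦ adj x y ⟧ ⊕ ⟦ adj x y ∧ true ⟧ ≤ᶻ 0ℤ
    edgeless x y x∈ y∈ with adj x y in eq
    ... | false = ≤-refl
    ... | true  = ⊥-elim (noK₂ (x , x∈ , y , ∈-filter⁺ (λ z → T? (adj x z)) y∈ (subst T (sym eq) tt) , tt))
  clique-free⇒colouring adj-sym (ℕ.suc k) S@(x₀ ∷ xs) noK with max-degree x₀ xs
  ... | x , x∈ , maximal with clique-free⇒colouring adj-sym k (filterᵇ (adj x) S) (λ clique → noK (x , x∈ , clique))
  ... | col′ , respects′ , bound′ = col , respects respects′ , bound maximal bound′
    where open Recolour adj-sym S x col′

-- Elementary abelian 2-groups

module _ {A : Set} where

  lookup-injective : ∀ {xs : List A} → Unique xs → ∀ i j → List.lookup xs i ≡ List.lookup xs j → i ≡ j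
  lookup-injective (_  ∷ _)  zero    zero    _  = refl
  lookup-injective (x∉ ∷ _)  zero    (suc j) eq = ⊥-elim (All.lookup x∉ (∈-lookup j) eq)
  lookup-injective (x∉ ∷ _)  (suc i) zero    eq = ⊥-elim (All.lookup x∉ (∈-lookup i) (sym eq))
  lookup-injective (_  ∷ xs!) (suc i) (suc j) eq = cong suc (lookup-injective xs! i j eq)

length-unique-≤ : ∀ {s} {xs : List (Fin s)} → Unique xs → length xs ℕ.≤ s
length-unique-≤ xs! = injective⇒≤ (λ {i} {j} → lookup-injective xs! i j)

≤-length-exhaustive : ∀ {s} {xs : List (Fin s)} → (∀ i → i ∈ xs) → s ℕ.≤ length xs
≤-length-exhaustive {s} ∈xs = injective⇒≤ (λ {i} {j} eq → SetoidMembership.index-injective (setoid (Fin s)) (∈xs i) (∈xs j) eq)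

-- A proper subgroup L and an element g outside it generate the subgroup L ∪ gL of twice the order.
module _ {s : ℕ} (i₀ : Fin s) (_∙_ : Fin s → Fin s → Fin s)
         (assoc : ∀ i j k → (i ∙ j) ∙ k ≡ i ∙ (j ∙ k))
         (comm : ∀ i j → i ∙ j ≡ j ∙ i)
         (involutive : ∀ i j → i ∙ (i ∙ j) ≡ j) where

  open DecMembership (Fin._≟_ {s}) using () renaming (_∈?_ to _∈ᶠ?_)
  open ≡-Reasoning

  Closed : List (Fin s) → Set
  Closed L = ∀ {x y} → x ∈ L → y ∈ L → x ∙ y ∈ L

  swapˡ : ∀ x g y → x ∙ (g ∙ y) ≡ g ∙ (x ∙ y)
  swapˡ x g y = begin
    x ∙ (g ∙ y)  ≡⟨ sym (assoc x g y) ⟩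
    (x ∙ g) ∙ y  ≡⟨ cong (_∙ y) (comm x g) ⟩
    (g ∙ x) ∙ y  ≡⟨ assoc g x y ⟩
    g ∙ (x ∙ y)  ∎

  module Doubling (L : List (Fin s)) (L! : Unique L) (closed : Closed L) (g : Fin s) (g∉L : g ∉ L) where

    L₂ = L ++ map (g ∙_) L

    L₂! : Unique L₂
    L₂! = ++⁺ L! (map⁺ (λ {x} {y} eq → trans (sym (involutive g x)) (trans (cong (g ∙_) eq) (involutive g y))) L!) disjoint
      where
      disjoint : ∀ {h} → ¬ (h ∈ L × h ∈ map (g ∙_) L)
      disjoint (h∈ , gh∈) with ∈-map⁻ (g ∙_) gh∈
      -- From `h = g ∙ y` the element `g = y ∙ h` would be a product of two members of `L`.
      ... | y , y∈ , refl = g∉L (subst (_∈ L) (trans (cong (y ∙_) (comm g y)) (involutive y g)) (closed y∈ h∈))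

    closed₂ : Closed L₂
    closed₂ x∈ y∈ with ∈-++⁻ L x∈ | ∈-++⁻ L y∈
    ... | inj₁ x∈L | inj₁ y∈L = ∈-++⁺ˡ (closed x∈L y∈L)
    closed₂ {x} x∈ y∈ | inj₁ x∈L | inj₂ y∈gL with ∈-map⁻ (g ∙_) y∈gL
    ... | y , y∈L , refl = ∈-++⁺ʳ L (subst (_∈ map (g ∙_) L) (sym (swapˡ x g y)) (∈-map⁺ (g ∙_) (closed x∈L y∈L)))
    closed₂ {y = y} x∈ y∈ | inj₂ x∈gL | inj₁ y∈L with ∈-map⁻ (g ∙_) x∈gL
    ... | x , x∈L , refl = ∈-++⁺ʳ L (subst (_∈ map (g ∙_) L) (sym (assoc g x y)) (∈-map⁺ (g ∙_) (closed x∈L y∈L)))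
    closed₂ x∈ y∈ | inj₂ x∈gL | inj₂ y∈gL with ∈-map⁻ (g ∙_) x∈gL | ∈-map⁻ (g ∙_) y∈gL
    ... | x , x∈L , refl | y , y∈L , refl = ∈-++⁺ˡ (subst (_∈ L) eq (closed x∈L y∈L))
      where
      eq : x ∙ y ≡ (g ∙ x) ∙ (g ∙ y)
      eq = begin
        x ∙ y              ≡⟨ sym (involutive g (x ∙ y)) ⟩
        g ∙ (g ∙ (x ∙ y))  ≡⟨ cong (g ∙_) (sym (swapˡ x g y)) ⟩
        g ∙ (x ∙ (g ∙ y))  ≡⟨ sym (assoc g x (g ∙ y)) ⟩
        (g ∙ x) ∙ (g ∙ y)  ∎

    length₂ : ∀ {p} → length L ≡ 2 ℕ.^ p → length L₂ ≡ 2 ℕ.^ ℕ.suc p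
    length₂ {p} eq = begin
      length L₂                            ≡⟨ length-++ L ⟩
      length L ℕ.+ length (map (g ∙_) L)   ≡⟨ cong (length L ℕ.+_) (length-map (g ∙_) L) ⟩
      length L ℕ.+ length L                ≡⟨ cong₂ ℕ._+_ eq (trans eq (sym (ℕ.+-identityʳ (2 ℕ.^ p)))) ⟩
      2 ℕ.^ ℕ.suc p                        ∎

  grow : ∀ fuel L → Unique L → Closed L → ∀ p → length L ≡ 2 ℕ.^ p → s ℕ.≤ length L ℕ.+ fuel →
         ∃[ q ] s ≡ 2 ℕ.^ q
  grow fuel L L! closed p eq bound with any? (λ g → ¬? (g ∈ᶠ? L))
  ... | no  full = p , trans (ℕ.≤-antisym (≤-length-exhaustive λ i → decidable-stable (i ∈ᶠ? L) (λ i∉ → full (i , i∉)))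
                                          (length-unique-≤ L!)) eq
  grow fuel L L! closed p eq bound | yes (g , g∉L) = go fuel bound
    where
    open Doubling L L! closed g g∉L
    suc-length≤ : ℕ.suc (length L) ℕ.≤ s
    suc-length≤ = length-unique-≤ (All.¬Any⇒All¬ L g∉L ∷ L!)
    go : ∀ f → s ℕ.≤ length L ℕ.+ f → ∃[ q ] s ≡ 2 ℕ.^ q
    go ℕ.zero    b = ⊥-elim (ℕ.1+n≰n (ℕ.≤-trans suc-length≤ (subst (s ℕ.≤_) (ℕ.+-identityʳ (length L)) b)))
    go (ℕ.suc f) b = grow f L₂ L₂! closed₂ (ℕ.suc p) (length₂ {p} eq) (ℕ.≤-trans b enough)
      where
      0<length : 0 ℕ.< length L
      0<length = subst (0 ℕ.<_) (sym eq) (ℕ.m^n>0 2 p)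
      enough : length L ℕ.+ ℕ.suc f ℕ.≤ length L₂ ℕ.+ f
      enough = ℕ.≤-trans (ℕ.≤-reflexive (ℕ.+-suc (length L) f)) (ℕ.+-monoˡ-≤ f (ℕ.≤-trans
        (ℕ.≤-reflexive (ℕ.+-comm 1 (length L)))
        (ℕ.≤-trans (ℕ.+-monoʳ-≤ (length L) 0<length)
          (ℕ.≤-reflexive (sym (trans (length-++ L) (cong (length L ℕ.+_) (length-map (g ∙_) L))))))))

  order-power-of-two : ∃[ q ] s ≡ 2 ℕ.^ q
  order-power-of-two = grow s (e ∷ []) ([] ∷ []) e-closed 0 refl (ℕ.n≤1+n s)
    where
    -- The identity: `(i₀ ∙ i₀) ∙ j = i₀ ∙ (i₀ ∙ j) = j`.
    e = i₀ ∙ i₀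
    e-closed : Closed (e ∷ [])
    e-closed (here refl) (here refl) = here (trans (assoc i₀ i₀ e) (involutive i₀ e))

-- Almost consistent edge colourings

-- Lagrange's identity: the difference of the two sides is half the sum of `(f x - f y)²` over
-- ordered pairs.
cauchy-schwarz : ∀ {A : Set} (xs : List A) (f : A → ℤ) →
  ∑ xs f ⊗ ∑ xs f ≤ᶻ + length xs ⊗ (∑[ x ∈ xs ] (f x ⊗ f x))
cauchy-schwarz xs f = ²≤ (∑-nonneg xs λ x → ∑-nonneg xs λ y → 0≤x² (f x - f y)) expand
  where
  F = ∑ xs f
  F² = ∑[ x ∈ xs ] (f x ⊗ f x)
  L = + length xs
  square : ∀ a b → (a - b) ⊗ (a - b) ≡ (a ⊗ a ⊕ b ⊗ b) - + 2 ⊗ a ⊗ b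
  square = solve-∀
  expand : ∑[ x ∈ xs ] ∑[ y ∈ xs ] ((f x - f y) ⊗ (f x - f y)) ≡ + 2 ⊗ (L ⊗ F² - F ⊗ F)
  expand = begin
    ∑[ x ∈ xs ] ∑[ y ∈ xs ] ((f x - f y) ⊗ (f x - f y))
      ≡⟨ ∑-cong xs (λ x → inner x) ⟩
    ∑[ x ∈ xs ] ((L ⊗ (f x ⊗ f x) ⊕ F²) - + 2 ⊗ F ⊗ f x)
      ≡⟨ ∑-- xs (λ x → L ⊗ (f x ⊗ f x) ⊕ F²) (λ x → + 2 ⊗ F ⊗ f x) ⟩
    (∑[ x ∈ xs ] (L ⊗ (f x ⊗ f x) ⊕ F²)) - (∑[ x ∈ xs ] (+ 2 ⊗ F ⊗ f x))
      ≡⟨ cong₂ _-_ (trans (∑-+ xs (λ x → L ⊗ (f x ⊗ f x)) (λ _ → F²)) (cong₂ _⊕_ (∑-*ˡ xs L (λ x → f x ⊗ f x)) (∑-const xs F²)))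
                   (∑-*ˡ xs (+ 2 ⊗ F) f) ⟩
    (L ⊗ F² ⊕ L ⊗ F²) - + 2 ⊗ F ⊗ F
      ≡⟨ collect L F² F ⟩
    + 2 ⊗ (L ⊗ F² - F ⊗ F) ∎
    where
    open ≡-Reasoning
    collect : ∀ l q a → (l ⊗ q ⊕ l ⊗ q) - + 2 ⊗ a ⊗ a ≡ + 2 ⊗ (l ⊗ q - a ⊗ a)
    collect = solve-∀
    comm : ∀ a b → + 2 ⊗ a ⊗ b ≡ + 2 ⊗ b ⊗ a
    comm = solve-∀
    inner : ∀ x → ∑[ y ∈ xs ] ((f x - f y) ⊗ (f x - f y)) ≡ (L ⊗ (f x ⊗ f x) ⊕ F²) - + 2 ⊗ F ⊗ f x
    inner x = begin
      ∑[ y ∈ xs ] ((f x - f y) ⊗ (f x - f y))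
        ≡⟨ ∑-cong xs (λ y → square (f x) (f y)) ⟩
      ∑[ y ∈ xs ] ((f x ⊗ f x ⊕ f y ⊗ f y) - + 2 ⊗ f x ⊗ f y)
        ≡⟨ ∑-- xs (λ y → f x ⊗ f x ⊕ f y ⊗ f y) (λ y → + 2 ⊗ f x ⊗ f y) ⟩
      (∑[ y ∈ xs ] (f x ⊗ f x ⊕ f y ⊗ f y)) - (∑[ y ∈ xs ] (+ 2 ⊗ f x ⊗ f y))
        ≡⟨ cong₂ _-_ (trans (∑-+ xs (λ _ → f x ⊗ f x) (λ y → f y ⊗ f y)) (cong (_⊕ F²) (∑-const xs (f x ⊗ f x))))
                     (trans (∑-*ˡ xs (+ 2 ⊗ f x) f) (comm (f x) F)) ⟩
      (L ⊗ (f x ⊗ f x) ⊕ F²) - + 2 ⊗ F ⊗ f x ∎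
  ²≤ : ∀ {t u v} → 0ℤ ≤ᶻ t → t ≡ + 2 ⊗ (v - u) → u ≤ᶻ v
  ²≤ {t} {u} {v} 0≤t eq = 2-cancel (≤-trans 0≤t (≤-reflexive eq))
    where
    2-cancel : 0ℤ ≤ᶻ + 2 ⊗ (v - u) → u ≤ᶻ v
    2-cancel h = 0≤i-j⇒j≤i (*-cancelˡ-≤-pos 0ℤ (v - u) (+ 2) (≤-trans (≤-reflexive (*-zeroʳ (+ 2))) h))

-- The Gram matrices `u uᵀ` and `uᵀ u` have the same Frobenius norm. This turns information about
-- pairs of vertices into information about pairs of colours.
gram-swap : ∀ {A B : Set} (xs : List A) (ys : List B) (u : A → B → ℤ) →
  ∑[ a ∈ xs ] ∑[ d ∈ xs ] ((∑[ i ∈ ys ] (u a i ⊗ u d i)) ⊗ (∑[ i ∈ ys ] (u a i ⊗ u d i))) ≡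
  ∑[ i ∈ ys ] ∑[ j ∈ ys ] ((∑[ a ∈ xs ] (u a i ⊗ u a j)) ⊗ (∑[ a ∈ xs ] (u a i ⊗ u a j)))
gram-swap xs ys u = begin
  ∑[ a ∈ xs ] ∑[ d ∈ xs ] ((∑[ i ∈ ys ] (u a i ⊗ u d i)) ⊗ (∑[ i ∈ ys ] (u a i ⊗ u d i)))
    ≡⟨ ∑-cong xs (λ a → ∑-cong xs λ d → ∑-*-∑ ys ys (λ i → u a i ⊗ u d i) (λ j → u a j ⊗ u d j)) ⟩
  ∑[ a ∈ xs ] ∑[ d ∈ xs ] ∑[ i ∈ ys ] ∑[ j ∈ ys ] t a d i j
    ≡⟨ ∑-cong xs (λ a → ∑-swap xs ys (λ d i → ∑[ j ∈ ys ] t a d i j)) ⟩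
  ∑[ a ∈ xs ] ∑[ i ∈ ys ] ∑[ d ∈ xs ] ∑[ j ∈ ys ] t a d i j
    ≡⟨ ∑-swap xs ys (λ a i → ∑[ d ∈ xs ] ∑[ j ∈ ys ] t a d i j) ⟩
  ∑[ i ∈ ys ] ∑[ a ∈ xs ] ∑[ d ∈ xs ] ∑[ j ∈ ys ] t a d i j
    ≡⟨ ∑-cong ys (λ i → ∑-cong xs λ a → ∑-swap xs ys (λ d j → t a d i j)) ⟩
  ∑[ i ∈ ys ] ∑[ a ∈ xs ] ∑[ j ∈ ys ] ∑[ d ∈ xs ] t a d i j
    ≡⟨ ∑-cong ys (λ i → ∑-swap xs ys (λ a j → ∑[ d ∈ xs ] t a d i j)) ⟩
  ∑[ i ∈ ys ] ∑[ j ∈ ys ] ∑[ a ∈ xs ] ∑[ d ∈ xs ] t a d i j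
    ≡⟨ ∑-cong ys (λ i → ∑-cong ys λ j → trans (∑-cong xs λ a → ∑-cong xs λ d → regroup (u a i) (u d i) (u a j) (u d j))
         (sym (∑-*-∑ xs xs (λ a → u a i ⊗ u a j) (λ d → u d i ⊗ u d j)))) ⟩
  ∑[ i ∈ ys ] ∑[ j ∈ ys ] ((∑[ a ∈ xs ] (u a i ⊗ u a j)) ⊗ (∑[ a ∈ xs ] (u a i ⊗ u a j))) ∎
  where
  open ≡-Reasoning
  t = λ a d i j → (u a i ⊗ u d i) ⊗ (u a j ⊗ u d j)
  regroup : ∀ x y z w → (x ⊗ y) ⊗ (z ⊗ w) ≡ (x ⊗ z) ⊗ (y ⊗ w)
  regroup = solve-∀

⟦⟧≤ : ∀ {b r} → 0ℤ ≤ᶻ r → (b ≡ true → 1ℤ ≤ᶻ r) → ⟦ b ⟧ ≤ᶻ r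
⟦⟧≤ {true}  _   1≤r = 1≤r refl
⟦⟧≤ {false} 0≤r _   = 0≤r

-- N and S are variables because multiplication by the literals + length V and + s would unfold.
module Counting {A : Set} (V : List A) (N : ℤ) (N≡ : N ≡ + length V) {s : ℕ} (S : ℤ) (S≡ : S ≡ + s)
                (col : A → A → Fin s) (col-sym : ∀ a b → col a b ≡ col b a) where

  Γ = allFin s

  0≤N : 0ℤ ≤ᶻ N
  0≤N = subst (0ℤ ≤ᶻ_) (sym N≡) 0≤+

  0≤S : 0ℤ ≤ᶻ S
  0≤S = subst (0ℤ ≤ᶻ_) (sym S≡) 0≤+

  ∑V-const : ∀ k → ∑[ a ∈ V ] k ≡ N ⊗ k
  ∑V-const k = trans (∑-const V k) (cong (_⊗ k) (sym N≡))

  ∑Γ-const : ∀ k → ∑[ i ∈ Γ ] k ≡ S ⊗ k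
  ∑Γ-const k = trans (∑-const-allFin s k) (cong (_⊗ k) (sym S≡))

  cauchy-schwarzV : ∀ f → ∑ V f ⊗ ∑ V f ≤ᶻ N ⊗ (∑[ x ∈ V ] (f x ⊗ f x))
  cauchy-schwarzV f = ≤-trans (cauchy-schwarz V f) (≤-reflexive (cong (_⊗ (∑[ x ∈ V ] (f x ⊗ f x))) (sym N≡)))

  ∑² : (A → A → ℤ) → ℤ
  ∑² f = ∑[ a ∈ V ] ∑[ b ∈ V ] f a b

  ∑³ : (A → A → A → ℤ) → ℤ
  ∑³ f = ∑[ a ∈ V ] ∑² (f a)

  ∑⁴ : (A → A → A → A → ℤ) → ℤ
  ∑⁴ f = ∑[ a ∈ V ] ∑³ (f a)

  ∑²-cong : ∀ {f g} → (∀ a b → f a b ≡ g a b) → ∑² f ≡ ∑² g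
  ∑²-cong f≡g = ∑-cong V λ a → ∑-cong V (f≡g a)

  ∑²-mono : ∀ {f g} → (∀ a b → f a b ≤ᶻ g a b) → ∑² f ≤ᶻ ∑² g
  ∑²-mono f≤g = ∑-mono V λ a → ∑-mono V (f≤g a)

  ∑²-+ : ∀ f g → ∑² (λ a b → f a b ⊕ g a b) ≡ ∑² f ⊕ ∑² g
  ∑²-+ f g = trans (∑-cong V λ a → ∑-+ V (f a) (g a)) (∑-+ V (λ a → ∑ V (f a)) (λ a → ∑ V (g a)))

  ∑²-- : ∀ f g → ∑² (λ a b → f a b - g a b) ≡ ∑² f - ∑² g
  ∑²-- f g = trans (∑-cong V λ a → ∑-- V (f a) (g a)) (∑-- V (λ a → ∑ V (f a)) (λ a → ∑ V (g a)))

  ∑²-*ˡ : ∀ k f → ∑² (λ a b → k ⊗ f a b) ≡ k ⊗ ∑² f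
  ∑²-*ˡ k f = trans (∑-cong V λ a → ∑-*ˡ V k (f a)) (∑-*ˡ V k λ a → ∑ V (f a))

  ∑²-const : ∀ k → ∑² (λ _ _ → k) ≡ N ⊗ (N ⊗ k)
  ∑²-const k = trans (∑-cong V λ a → ∑V-const k) (∑V-const (N ⊗ k))

  ∑³-*ˡ : ∀ k f → ∑³ (λ a b c → k ⊗ f a b c) ≡ k ⊗ ∑³ f
  ∑³-*ˡ k f = trans (∑-cong V λ a → ∑²-*ˡ k (f a)) (∑-*ˡ V k λ a → ∑² (f a))

  ∑³-mono : ∀ {f g} → (∀ a b c → f a b c ≤ᶻ g a b c) → ∑³ f ≤ᶻ ∑³ g
  ∑³-mono f≤g = ∑-mono V λ a → ∑²-mono (f≤g a)

  ∑³-cong : ∀ {f g} → (∀ a b c → f a b c ≡ g a b c) → ∑³ f ≡ ∑³ g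
  ∑³-cong f≡g = ∑-cong V λ a → ∑²-cong (f≡g a)

  ∑³-+ : ∀ f g → ∑³ (λ a b c → f a b c ⊕ g a b c) ≡ ∑³ f ⊕ ∑³ g
  ∑³-+ f g = trans (∑-cong V λ a → ∑²-+ (f a) (g a)) (∑-+ V (λ a → ∑² (f a)) (λ a → ∑² (g a)))

  ∑⁴-+ : ∀ f g → ∑⁴ (λ a b c d → f a b c d ⊕ g a b c d) ≡ ∑⁴ f ⊕ ∑⁴ g
  ∑⁴-+ f g = trans (∑-cong V λ a → ∑³-+ (f a) (g a)) (∑-+ V (λ a → ∑³ (f a)) (λ a → ∑³ (g a)))

  ∑⁴-- : ∀ f g → ∑⁴ (λ a b c d → f a b c d - g a b c d) ≡ ∑⁴ f - ∑⁴ g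
  ∑⁴-- f g = trans (∑-cong V λ a → trans (∑-cong V λ b → ∑²-- (f a b) (g a b)) (∑-- V (λ b → ∑² (f a b)) (λ b → ∑² (g a b))))
    (∑-- V (λ a → ∑³ (f a)) (λ a → ∑³ (g a)))

  -- Colour degrees and their second moment

  e : Fin s → A → A → ℤ
  e i a b = ⟦ col a b == i ⟧

  p : A → Fin s → ℤ
  p a i = ∑ V (e i a)

  m : Fin s → ℤ
  m i = ∑[ a ∈ V ] p a i

  w : A → Fin s → ℤ
  w a i = S ⊗ p a i - N

  -- The 4-tuples on which col fails to behave like the sum of labels in an elementary abelian 2-group.
  bad : A → A → A → A → ℤ
  bad a b c d = ⟦ (col a b == col c d) xor (col a c == col b d) ⟧

  ∑-e : ∀ a b (f : Fin s → ℤ) → ∑[ i ∈ Γ ] (e i a b ⊗ f i) ≡ f (col a b)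
  ∑-e a b f = ∑-pick (col a b) f

  ∑-p : ∀ a → ∑[ i ∈ Γ ] p a i ≡ N
  ∑-p a = begin
    ∑[ i ∈ Γ ] ∑[ b ∈ V ] e i a b          ≡⟨ ∑-swap Γ V (λ i b → e i a b) ⟩
    ∑[ b ∈ V ] ∑[ i ∈ Γ ] e i a b          ≡⟨ ∑-cong V (λ b → trans (∑-cong Γ λ i → sym (*-identityʳ (e i a b))) (∑-e a b (λ _ → 1ℤ))) ⟩
    ∑[ b ∈ V ] 1ℤ                          ≡⟨ ∑V-const 1ℤ ⟩
    N ⊗ 1ℤ                                 ≡⟨ *-identityʳ N ⟩
    N                                      ∎
    where open ≡-Reasoning

  inner : A → A → ℤ
  inner a d = ∑[ i ∈ Γ ] (p a i ⊗ p d i)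

  inner-count : ∀ a d → inner a d ≡ ∑² λ b c → ⟦ col d c == col a b ⟧
  inner-count a d = begin
    ∑[ i ∈ Γ ] (p a i ⊗ p d i)
      ≡⟨ ∑-cong Γ (λ i → ∑-*-∑ V V (e i a) (e i d)) ⟩
    ∑[ i ∈ Γ ] ∑[ b ∈ V ] ∑[ c ∈ V ] (e i a b ⊗ e i d c)
      ≡⟨ ∑-swap Γ V (λ i b → ∑[ c ∈ V ] (e i a b ⊗ e i d c)) ⟩
    ∑[ b ∈ V ] ∑[ i ∈ Γ ] ∑[ c ∈ V ] (e i a b ⊗ e i d c)
      ≡⟨ ∑-cong V (λ b → ∑-swap Γ V (λ i c → e i a b ⊗ e i d c)) ⟩
    ∑[ b ∈ V ] ∑[ c ∈ V ] ∑[ i ∈ Γ ] (e i a b ⊗ e i d c)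
      ≡⟨ ∑²-cong (λ b c → ∑-e a b (λ i → e i d c)) ⟩
    ∑² (λ b c → ⟦ col d c == col a b ⟧) ∎
    where open ≡-Reasoning

  -- `inner a d` counts the `b`, `c` for which `ab` and `dc` have the same colour. If no tuple
  -- `b a c d` were bad, these would be the `b`, `c` for which `bc` has the colour of `ad`, and
  -- there are `m (col a d)` of them. Cauchy-Schwarz is used once for each summation variable.
  inner-deviation : ∀ a d → (inner a d - m (col a d)) ⊗ (inner a d - m (col a d)) ≤ᶻ N ⊗ (N ⊗ ∑² λ b c → bad b a c d)
  inner-deviation a d = begin
    (inner a d - m (col a d)) ⊗ (inner a d - m (col a d))
      ≡⟨ cong (λ t → t ⊗ t) (trans (cong (_- m (col a d)) (inner-count a d)) (sym (∑²-- (λ b c → ⟦ col d c == col a b ⟧) (e (col a d))))) ⟩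
    ∑² x ⊗ ∑² x
      ≤⟨ cauchy-schwarzV (λ b → ∑ V (x b)) ⟩
    N ⊗ (∑[ b ∈ V ] (∑ V (x b) ⊗ ∑ V (x b)))
      ≤⟨ *-monoˡ 0≤N (∑-mono V λ b → cauchy-schwarzV (x b)) ⟩
    N ⊗ (∑[ b ∈ V ] (N ⊗ (∑[ c ∈ V ] (x b c ⊗ x b c))))
      ≡⟨ cong (N ⊗_) (∑-*ˡ V N (λ b → ∑[ c ∈ V ] (x b c ⊗ x b c))) ⟩
    N ⊗ (N ⊗ ∑² (λ b c → x b c ⊗ x b c))
      ≤⟨ *-monoˡ 0≤N (*-monoˡ 0≤N (∑²-mono x²≤bad)) ⟩
    N ⊗ (N ⊗ ∑² λ b c → bad b a c d) ∎
    where
    open ≤-Reasoning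
    x : A → A → ℤ
    x b c = ⟦ col d c == col a b ⟧ - ⟦ col b c == col a d ⟧
    x²≤bad : ∀ b c → x b c ⊗ x b c ≤ᶻ bad b a c d
    x²≤bad b c rewrite col-sym b a | col-sym c d | ==-sym (col a b) (col d c) with col d c == col a b | col b c == col a d
    ... | true  | true  = ≤-refl
    ... | true  | false = ≤-refl
    ... | false | true  = ≤-refl
    ... | false | false = ≤-refl

  N² = N ⊗ N
  N³ = N ⊗ N²
  N⁴ = N ⊗ N³

  excess : Fin s → ℤ
  excess i = S ⊗ m i - N²

  total-excess : ℤ
  total-excess = ∑[ i ∈ Γ ] (excess i ⊗ excess i)

  dot : A → A → ℤ
  dot a d = ∑[ i ∈ Γ ] (w a i ⊗ w d i)

  dot≡ : ∀ a d → dot a d ≡ S ⊗ (S ⊗ inner a d - N²)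
  dot≡ a d = begin
    ∑[ i ∈ Γ ] (w a i ⊗ w d i)
      ≡⟨ ∑-cong Γ (λ i → expand S N (p a i) (p d i)) ⟩
    ∑[ i ∈ Γ ] ((S ⊗ S ⊗ (p a i ⊗ p d i) ⊕ N²) - S ⊗ N ⊗ (p a i ⊕ p d i))
      ≡⟨ ∑-- Γ (λ i → S ⊗ S ⊗ (p a i ⊗ p d i) ⊕ N²) (λ i → S ⊗ N ⊗ (p a i ⊕ p d i)) ⟩
    (∑[ i ∈ Γ ] (S ⊗ S ⊗ (p a i ⊗ p d i) ⊕ N²)) - (∑[ i ∈ Γ ] (S ⊗ N ⊗ (p a i ⊕ p d i)))
      ≡⟨ cong₂ _-_ (trans (∑-+ Γ (λ i → S ⊗ S ⊗ (p a i ⊗ p d i)) (λ _ → N²)) (cong₂ _⊕_ (∑-*ˡ Γ (S ⊗ S) (λ i → p a i ⊗ p d i)) (∑Γ-const N²)))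
                   (trans (∑-*ˡ Γ (S ⊗ N) (λ i → p a i ⊕ p d i)) (cong (S ⊗ N ⊗_) (trans (∑-+ Γ (p a) (p d)) (cong₂ _⊕_ (∑-p a) (∑-p d))))) ⟩
    (S ⊗ S ⊗ inner a d ⊕ S ⊗ N²) - S ⊗ N ⊗ (N ⊕ N)
      ≡⟨ collect S N (inner a d) ⟩
    S ⊗ (S ⊗ inner a d - N²) ∎
    where
    open ≡-Reasoning
    expand : ∀ s n x y → (s ⊗ x - n) ⊗ (s ⊗ y - n) ≡ (s ⊗ s ⊗ (x ⊗ y) ⊕ n ⊗ n) - s ⊗ n ⊗ (x ⊕ y)
    expand = solve-∀
    collect : ∀ s n x → (s ⊗ s ⊗ x ⊕ s ⊗ (n ⊗ n)) - s ⊗ n ⊗ (n ⊕ n) ≡ s ⊗ (s ⊗ x - n ⊗ n)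
    collect = solve-∀

  -- With `m = m (col a d)`, `S · inner a d - N²` is `S (inner a d - m)`, caused by bad tuples, plus
  -- `S m - N²`, the imbalance of one colour class; `(x + y)² ≤ 2x² + 2y²` separates the two.
  dot²≤ : ∀ a d → dot a d ⊗ dot a d ≤ᶻ
          (+ 2 ⊗ S ⊗ S) ⊗ (S ⊗ S ⊗ N² ⊗ (∑² λ b c → bad b a c d) ⊕ total-excess)
  dot²≤ a d = begin
    dot a d ⊗ dot a d
      ≡⟨ cong (λ t → t ⊗ t) (dot≡ a d) ⟩
    (S ⊗ (S ⊗ inner a d - N²)) ⊗ (S ⊗ (S ⊗ inner a d - N²))
      ≤⟨ ≤-by-difference (0≤-* (0≤x² S) (0≤x² (S ⊗ D - q))) (parallelogram S N (inner a d) (m (col a d))) ⟩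
    (+ 2 ⊗ S ⊗ S) ⊗ (S ⊗ S ⊗ (D ⊗ D) ⊕ q ⊗ q)
      ≤⟨ *-monoˡ 0≤2SS (+-mono-≤ (*-monoˡ (0≤x² S) (inner-deviation a d))
           (term≤∑ (λ i → 0≤x² (excess i)) (∈-allFin (col a d)))) ⟩
    (+ 2 ⊗ S ⊗ S) ⊗ (S ⊗ S ⊗ (N ⊗ (N ⊗ B)) ⊕ total-excess)
      ≡⟨ cong (λ t → (+ 2 ⊗ S ⊗ S) ⊗ (t ⊕ total-excess)) (reassoc (S ⊗ S) N B) ⟩
    (+ 2 ⊗ S ⊗ S) ⊗ (S ⊗ S ⊗ N² ⊗ B ⊕ total-excess) ∎
    where
    open ≤-Reasoning
    D = inner a d - m (col a d)
    q = excess (col a d)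
    B = ∑² λ b c → bad b a c d
    0≤2SS : 0ℤ ≤ᶻ + 2 ⊗ S ⊗ S
    0≤2SS = 0≤-* (0≤-* {+ 2} 0≤+ 0≤S) 0≤S
    reassoc : ∀ s n b → s ⊗ (n ⊗ (n ⊗ b)) ≡ s ⊗ (n ⊗ n) ⊗ b
    reassoc = solve-∀
    parallelogram : ∀ s n f μ →
      (+ 2 ⊗ s ⊗ s) ⊗ (s ⊗ s ⊗ ((f - μ) ⊗ (f - μ)) ⊕ (s ⊗ μ - n ⊗ n) ⊗ (s ⊗ μ - n ⊗ n)) - (s ⊗ (s ⊗ f - n ⊗ n)) ⊗ (s ⊗ (s ⊗ f - n ⊗ n)) ≡
      (s ⊗ s) ⊗ ((s ⊗ (f - μ) - (s ⊗ μ - n ⊗ n)) ⊗ (s ⊗ (f - μ) - (s ⊗ μ - n ⊗ n)))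
    parallelogram = solve-∀

  ∑⁴-adbc : ∀ (f : A → A → A → A → ℤ) → ∑² (λ a d → ∑² λ b c → f b a c d) ≡ ∑⁴ f
  ∑⁴-adbc f = begin
    ∑² (λ a d → ∑² λ b c → f b a c d)
      ≡⟨ ∑-cong V (λ a → ∑-swap V V (λ d b → ∑[ c ∈ V ] f b a c d)) ⟩
    ∑² (λ a b → ∑² λ d c → f b a c d)
      ≡⟨ ∑-swap V V (λ a b → ∑² λ d c → f b a c d) ⟩
    ∑² (λ b a → ∑² λ d c → f b a c d)
      ≡⟨ ∑²-cong (λ b a → ∑-swap V V (λ d c → f b a c d)) ⟩
    ∑⁴ f ∎
    where open ≡-Reasoning

  ∑-dot² : ∑² (λ a d → dot a d ⊗ dot a d) ≤ᶻ (+ 2 ⊗ S ⊗ S) ⊗ (S ⊗ S ⊗ N² ⊗ ∑⁴ bad ⊕ N² ⊗ total-excess)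
  ∑-dot² = begin
    ∑² (λ a d → dot a d ⊗ dot a d)
      ≤⟨ ∑²-mono dot²≤ ⟩
    ∑² (λ a d → (+ 2 ⊗ S ⊗ S) ⊗ (S ⊗ S ⊗ N² ⊗ B a d ⊕ total-excess))
      ≡⟨ trans (∑²-*ˡ (+ 2 ⊗ S ⊗ S) (λ a d → S ⊗ S ⊗ N² ⊗ B a d ⊕ total-excess))
           (cong (+ 2 ⊗ S ⊗ S ⊗_) (∑²-+ (λ a d → S ⊗ S ⊗ N² ⊗ B a d) (λ _ _ → total-excess))) ⟩
    (+ 2 ⊗ S ⊗ S) ⊗ (∑² (λ a d → S ⊗ S ⊗ N² ⊗ B a d) ⊕ ∑² (λ _ _ → total-excess))
      ≡⟨ cong (+ 2 ⊗ S ⊗ S ⊗_) (cong₂ _⊕_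
           (trans (∑²-*ˡ (S ⊗ S ⊗ N²) B) (cong (S ⊗ S ⊗ N² ⊗_) (∑⁴-adbc bad)))
           (trans (∑²-const total-excess) (sym (*-assoc N N total-excess)))) ⟩
    (+ 2 ⊗ S ⊗ S) ⊗ (S ⊗ S ⊗ N² ⊗ ∑⁴ bad ⊕ N² ⊗ total-excess) ∎
    where
    open ≤-Reasoning
    B : A → A → ℤ
    B a d = ∑² λ b c → bad b a c d

  -- A diagonal entry of the `s` by `s` Gram matrix of the vectors `w a`. Its smallness says that
  -- colour `i` has nearly its mean degree at almost every vertex.
  square-mass : Fin s → ℤ
  square-mass i = ∑[ a ∈ V ] (w a i ⊗ w a i)

  -- Only the (i , i) term of the Gram matrix is kept.
  square-mass²≤ : ∀ i → square-mass i ⊗ square-mass i ≤ᶻ ∑² (λ a d → dot a d ⊗ dot a d)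
  square-mass²≤ i = ≤-trans (≤-trans (term≤∑ (λ j → 0≤x² (∑[ a ∈ V ] (w a i ⊗ w a j))) (∈-allFin i))
    (term≤∑ (λ i → ∑-nonneg Γ λ j → 0≤x² (∑[ a ∈ V ] (w a i ⊗ w a j))) (∈-allFin i)))
    (≤-reflexive (sym (gram-swap V Γ w)))

  -- Paths with three prescribed colours

  path : Fin s → Fin s → Fin s → A → A → A → A → ℤ
  path i j k a b c d = e i a b ⊗ (e j b c ⊗ e k c d)

  ∑-path : ∀ i j k → ∑⁴ (path i j k) ≡ ∑² λ b c → e j b c ⊗ (p b i ⊗ p c k)
  ∑-path i j k = begin
    ∑⁴ (path i j k)
      ≡⟨ ∑³-cong (λ a b c → trans (∑-*ˡ V (e i a b) (λ d → e j b c ⊗ e k c d)) (cong (e i a b ⊗_) (∑-*ˡ V (e j b c) (e k c)))) ⟩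
    ∑³ (λ a b c → e i a b ⊗ (e j b c ⊗ p c k))
      ≡⟨ ∑-swap V V (λ a b → ∑[ c ∈ V ] (e i a b ⊗ (e j b c ⊗ p c k))) ⟩
    ∑² (λ b a → ∑[ c ∈ V ] (e i a b ⊗ (e j b c ⊗ p c k)))
      ≡⟨ ∑-cong V (λ b → ∑-swap V V (λ a c → e i a b ⊗ (e j b c ⊗ p c k))) ⟩
    ∑² (λ b c → ∑[ a ∈ V ] (e i a b ⊗ (e j b c ⊗ p c k)))
      ≡⟨ ∑²-cong (λ b c → trans (∑-*ʳ V (e j b c ⊗ p c k) (λ a → e i a b))
           (trans (cong (_⊗ (e j b c ⊗ p c k)) (∑-cong V λ a → cong (λ x → ⟦ x == i ⟧) (col-sym a b)))
                  (rotate (p b i) (e j b c) (p c k)))) ⟩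
    ∑² (λ b c → e j b c ⊗ (p b i ⊗ p c k)) ∎
    where
    open ≡-Reasoning
    rotate : ∀ x y z → x ⊗ (y ⊗ z) ≡ y ⊗ (x ⊗ z)
    rotate = solve-∀

  -- A path is a middle edge `bc` of colour `j` with `p b i · p c k` choices of ends, a product near
  -- `N²/S²`. Since only squares of deviations are controlled, it is bounded below, for each `b` and
  -- `c`, by half of this less a quadratic error.
  ∑-path-≥ : ∀ i j k → N² ⊗ m j - + 3 ⊗ (N ⊗ (square-mass i ⊕ square-mass k)) ≤ᶻ (+ 2 ⊗ S ⊗ S) ⊗ ∑⁴ (path i j k)
  ∑-path-≥ i j k = begin
    N² ⊗ m j - + 3 ⊗ (N ⊗ (square-mass i ⊕ square-mass k))
      ≡⟨ cong₂ (λ x y → x - + 3 ⊗ y) (sym (∑²-*ˡ N² (e j))) (sym ∑-squares) ⟩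
    ∑² (λ b c → N² ⊗ e j b c) - + 3 ⊗ ∑² (λ b c → w b i ⊗ w b i ⊕ w c k ⊗ w c k)
      ≡⟨ trans (cong (∑² (λ b c → N² ⊗ e j b c) -_) (sym (∑²-*ˡ (+ 3) (λ b c → w b i ⊗ w b i ⊕ w c k ⊗ w c k))))
               (sym (∑²-- (λ b c → N² ⊗ e j b c) (λ b c → + 3 ⊗ (w b i ⊗ w b i ⊕ w c k ⊗ w c k)))) ⟩
    ∑² (λ b c → N² ⊗ e j b c - + 3 ⊗ (w b i ⊗ w b i ⊕ w c k ⊗ w c k))
      ≤⟨ ∑²-mono (λ b c → pointwise (col b c == j) (p b i) (p c k)) ⟩
    ∑² (λ b c → (+ 2 ⊗ S ⊗ S) ⊗ (e j b c ⊗ (p b i ⊗ p c k)))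
      ≡⟨ trans (∑²-*ˡ (+ 2 ⊗ S ⊗ S) (λ b c → e j b c ⊗ (p b i ⊗ p c k))) (cong (+ 2 ⊗ S ⊗ S ⊗_) (sym (∑-path i j k))) ⟩
    (+ 2 ⊗ S ⊗ S) ⊗ ∑⁴ (path i j k) ∎
    where
    open ≤-Reasoning
    ∑-squares : ∑² (λ b c → w b i ⊗ w b i ⊕ w c k ⊗ w c k) ≡ N ⊗ (square-mass i ⊕ square-mass k)
    ∑-squares = trans (∑²-+ (λ b _ → w b i ⊗ w b i) (λ _ c → w c k ⊗ w c k))
      (trans (cong₂ _⊕_ (trans (∑-cong V λ b → ∑V-const (w b i ⊗ w b i)) (∑-*ˡ V N (λ b → w b i ⊗ w b i))) (∑V-const (square-mass k)))
             (factor N (square-mass i) (square-mass k)))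
      where
      factor : ∀ n x y → n ⊗ x ⊕ n ⊗ y ≡ n ⊗ (x ⊕ y)
      factor = solve-∀
    -- 2(n + x)(n + y) - n² + 3(x² + y²) = (n + x + y)² + 2x² + 2y² with x = s p - n, y = s q - n.
    sos : ∀ s n x y → (+ 2 ⊗ s ⊗ s) ⊗ (1ℤ ⊗ (x ⊗ y)) - (n ⊗ n ⊗ 1ℤ - + 3 ⊗ ((s ⊗ x - n) ⊗ (s ⊗ x - n) ⊕ (s ⊗ y - n) ⊗ (s ⊗ y - n))) ≡
      (s ⊗ x ⊕ s ⊗ y - n) ⊗ (s ⊗ x ⊕ s ⊗ y - n) ⊕ + 2 ⊗ ((s ⊗ x - n) ⊗ (s ⊗ x - n) ⊕ (s ⊗ y - n) ⊗ (s ⊗ y - n))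
    sos = solve-∀
    nil : ∀ s n x y → (+ 2 ⊗ s ⊗ s) ⊗ (0ℤ ⊗ (x ⊗ y)) - (n ⊗ n ⊗ 0ℤ - + 3 ⊗ ((s ⊗ x - n) ⊗ (s ⊗ x - n) ⊕ (s ⊗ y - n) ⊗ (s ⊗ y - n))) ≡
      + 3 ⊗ ((s ⊗ x - n) ⊗ (s ⊗ x - n) ⊕ (s ⊗ y - n) ⊗ (s ⊗ y - n))
    nil = solve-∀
    pointwise : ∀ t x y → N² ⊗ ⟦ t ⟧ - + 3 ⊗ ((S ⊗ x - N) ⊗ (S ⊗ x - N) ⊕ (S ⊗ y - N) ⊗ (S ⊗ y - N)) ≤ᶻ (+ 2 ⊗ S ⊗ S) ⊗ (⟦ t ⟧ ⊗ (x ⊗ y))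
    pointwise true  x y = ≤-by-difference (0≤-+ (0≤x² (S ⊗ x ⊕ S ⊗ y - N)) (0≤-* {+ 2} 0≤+ (0≤-+ (0≤x² (S ⊗ x - N)) (0≤x² (S ⊗ y - N))))) (sos S N x y)
    pointwise false x y = ≤-by-difference (0≤-* {+ 3} 0≤+ (0≤-+ (0≤x² (S ⊗ x - N)) (0≤x² (S ⊗ y - N)))) (nil S N x y)

  -- Triangles and the near-uniqueness of the third colour

  triangles : Fin s → Fin s → Fin s → ℤ
  triangles i j k = ∑³ λ a b c → e i a b ⊗ (e j b c ⊗ e k a c)

  triangles-swap₁₂ : ∀ i j k → triangles i j k ≡ triangles j i k
  triangles-swap₁₂ i j k = begin
    ∑³ (λ a b c → e i a b ⊗ (e j b c ⊗ e k a c))   ≡⟨ ∑-cong V (λ a → ∑-swap V V (λ b c → e i a b ⊗ (e j b c ⊗ e k a c))) ⟩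
    ∑³ (λ a c b → e i a b ⊗ (e j b c ⊗ e k a c))   ≡⟨ ∑-swap V V (λ a c → ∑[ b ∈ V ] (e i a b ⊗ (e j b c ⊗ e k a c))) ⟩
    ∑³ (λ c a b → e i a b ⊗ (e j b c ⊗ e k a c))   ≡⟨ ∑-cong V (λ c → ∑-swap V V (λ a b → e i a b ⊗ (e j b c ⊗ e k a c))) ⟩
    ∑³ (λ c b a → e i a b ⊗ (e j b c ⊗ e k a c))   ≡⟨ ∑³-cong (λ c b a → trans (rotate (e i a b) (e j b c) (e k a c)) (cong₂ _⊗_ (e-sym j b c) (cong₂ _⊗_ (e-sym i a b) (e-sym k a c)))) ⟩
    ∑³ (λ c b a → e j c b ⊗ (e i b a ⊗ e k c a))   ∎
    where
    open ≡-Reasoning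
    e-sym : ∀ i a b → e i a b ≡ e i b a
    e-sym i a b = cong (λ x → ⟦ x == i ⟧) (col-sym a b)
    rotate : ∀ x y z → x ⊗ (y ⊗ z) ≡ y ⊗ (x ⊗ z)
    rotate = solve-∀

  triangles-swap₂₃ : ∀ i j k → triangles i j k ≡ triangles i k j
  triangles-swap₂₃ i j k = trans (∑-swap V V (λ a b → ∑[ c ∈ V ] (e i a b ⊗ (e j b c ⊗ e k a c))))
    (∑³-cong (λ b a c → cong₂ _⊗_ (cong (λ x → ⟦ x == i ⟧) (col-sym a b)) (*-comm (e j b c) (e k a c))))

  -- If all three tuples were good, equal colours of `ab`, `a′b′` would give equal colours of `aa′`,
  -- `bb′`, and equal colours of `bc`, `b′c′` those of `bb′`, `cc′`. Then `aa′` and `cc′` agree,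
  -- hence so do `ac` and `a′c′`, against `k ≢ k′`.
  bad-triple : ∀ {i j k k′} → k ≢ k′ → ∀ a b c a′ b′ c′ →
    (e i a b ⊗ (e j b c ⊗ e k a c)) ⊗ (e i a′ b′ ⊗ (e j b′ c′ ⊗ e k′ a′ c′)) ≤ᶻ
    bad a b a′ b′ ⊕ (bad b c b′ c′ ⊕ bad a c a′ c′)
  bad-triple {i} {j} {k} {k′} k≢k′ a b c a′ b′ c′ =
    colours (col a b) (col b c) (col a c) (col a′ b′) (col b′ c′) (col a′ c′) (col a a′) (col b b′) (col c c′)
    where
    xor-≤ : ∀ s t → 0ℤ ≤ᶻ ⟦ s xor t ⟧
    xor-≤ s t = 0≤⟦⟧ (s xor t)
    colours : ∀ x y z x′ y′ z′ u v t →
      (⟦ x == i ⟧ ⊗ (⟦ y == j ⟧ ⊗ ⟦ z == k ⟧)) ⊗ (⟦ x′ == i ⟧ ⊗ (⟦ y′ == j ⟧ ⊗ ⟦ z′ == k′ ⟧)) ≤ᶻ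
      ⟦ (x == x′) xor (u == v) ⟧ ⊕ (⟦ (y == y′) xor (v == t) ⟧ ⊕ ⟦ (z == z′) xor (u == t) ⟧)
    colours x y z x′ y′ z′ u v t = ≤-trans (≤-reflexive (conj⁶ (x == i) (y == j) (z == k) (x′ == i) (y′ == j) (z′ == k′)))
      (⟦⟧≤ (0≤-+ (xor-≤ (x == x′) (u == v)) (0≤-+ (xor-≤ (y == y′) (v == t)) (xor-≤ (z == z′) (u == t)))) contrary)
      where
      conj⁶ : ∀ p q r p′ q′ r′ → (⟦ p ⟧ ⊗ (⟦ q ⟧ ⊗ ⟦ r ⟧)) ⊗ (⟦ p′ ⟧ ⊗ (⟦ q′ ⟧ ⊗ ⟦ r′ ⟧)) ≡ ⟦ p ∧ q ∧ r ∧ p′ ∧ q′ ∧ r′ ⟧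
      conj⁶ false q     r     p′    q′    r′    = refl
      conj⁶ true  false r     p′    q′    r′    = refl
      conj⁶ true  true  false p′    q′    r′    = refl
      conj⁶ true  true  true  false q′    r′    = refl
      conj⁶ true  true  true  true  false r′    = refl
      conj⁶ true  true  true  true  true  false = refl
      conj⁶ true  true  true  true  true  true  = refl
      contrary : ((x == i) ∧ (y == j) ∧ (z == k) ∧ (x′ == i) ∧ (y′ == j) ∧ (z′ == k′)) ≡ true →
        1ℤ ≤ᶻ ⟦ (x == x′) xor (u == v) ⟧ ⊕ (⟦ (y == y′) xor (v == t) ⟧ ⊕ ⟦ (z == z′) xor (u == t) ⟧)
      contrary eq with x ≟ i | y ≟ j | z ≟ k | x′ ≟ i | y′ ≟ j | z′ ≟ k′
      contrary () | no _     | _        | _        | _        | _        | _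
      contrary () | yes _    | no _     | _        | _        | _        | _
      contrary () | yes _    | yes _    | no _     | _        | _        | _
      contrary () | yes _    | yes _    | yes _    | no _     | _        | _
      contrary () | yes _    | yes _    | yes _    | yes _    | no _     | _
      contrary () | yes _    | yes _    | yes _    | yes _    | yes _    | no _
      contrary eq | yes refl | yes refl | yes refl | yes refl | yes refl | yes refl
        rewrite ==-refl i | ==-refl j with u ≟ v
      ... | no _ = +-mono-≤ (≤-refl {1ℤ}) (0≤-+ (xor-≤ true (v == t)) (xor-≤ (k == k′) (u == t)))
      ... | yes refl with u ≟ t
      ...   | no _ = +-mono-≤ (≤-refl {0ℤ}) (+-mono-≤ (≤-refl {1ℤ}) (0≤⟦⟧ ((k == k′) xor false)))
      ...   | yes _ with k ≟ k′
      ...     | yes k≡k′ = contradiction k≡k′ k≢k′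
      ...     | no _ = ≤-refl

  ∑³-*-∑³ : ∀ f g → ∑³ f ⊗ ∑³ g ≡ ∑³ λ a b c → ∑³ λ a′ b′ c′ → f a b c ⊗ g a′ b′ c′
  ∑³-*-∑³ f g = trans (trans (*-comm (∑³ f) (∑³ g)) (sym (∑³-*ˡ (∑³ g) f)))
    (∑³-cong λ a b c → trans (*-comm (∑³ g) (f a b c)) (sym (∑³-*ˡ (f a b c) g)))

  ∑⁶-bad₁₂ : ∑³ (λ a b c → ∑³ λ a′ b′ c′ → bad a b a′ b′) ≡ N² ⊗ ∑⁴ bad
  ∑⁶-bad₁₂ = begin
    ∑³ (λ a b c → ∑³ λ a′ b′ c′ → bad a b a′ b′)
      ≡⟨ ∑²-cong (λ a b → trans (∑V-const (∑³ λ a′ b′ c′ → bad a b a′ b′)) (cong (N ⊗_)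
           (trans (∑²-cong λ a′ b′ → ∑V-const (bad a b a′ b′)) (∑²-*ˡ N (bad a b))))) ⟩
    ∑² (λ a b → N ⊗ (N ⊗ ∑² (bad a b)))
      ≡⟨ trans (∑²-cong λ a b → sym (*-assoc N N (∑² (bad a b)))) (∑²-*ˡ N² (λ a b → ∑² (bad a b))) ⟩
    N² ⊗ ∑⁴ bad ∎
    where open ≡-Reasoning

  ∑⁶-bad₂₃ : ∑³ (λ a b c → ∑³ λ a′ b′ c′ → bad b c b′ c′) ≡ N² ⊗ ∑⁴ bad
  ∑⁶-bad₂₃ = begin
    ∑³ (λ a b c → ∑³ λ a′ b′ c′ → bad b c b′ c′)
      ≡⟨ trans (∑V-const (∑² λ b c → ∑³ λ a′ b′ c′ → bad b c b′ c′)) (cong (N ⊗_)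
           (trans (∑²-cong λ b c → ∑V-const (∑² (bad b c))) (∑²-*ˡ N (λ b c → ∑² (bad b c))))) ⟩
    N ⊗ (N ⊗ ∑⁴ bad)
      ≡⟨ sym (*-assoc N N (∑⁴ bad)) ⟩
    N² ⊗ ∑⁴ bad ∎
    where open ≡-Reasoning

  ∑⁶-bad₁₃ : ∑³ (λ a b c → ∑³ λ a′ b′ c′ → bad a c a′ c′) ≡ N² ⊗ ∑⁴ bad
  ∑⁶-bad₁₃ = trans (trans (∑-cong V λ a → ∑-swap V V (λ b c → ∑³ λ a′ b′ c′ → bad a c a′ c′))
    (∑³-cong λ a c b → ∑-cong V λ a′ → ∑-swap V V (λ b′ c′ → bad a c a′ c′))) ∑⁶-bad₁₂

  -- The product counts pairs of triangles. Each pair has a bad tuple in one of three positions, and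
  -- the two vertices outside that tuple are free, whence `N²`.
  triangles-*-triangles : ∀ {i j k k′} → k ≢ k′ → triangles i j k ⊗ triangles i j k′ ≤ᶻ + 3 ⊗ (N² ⊗ ∑⁴ bad)
  triangles-*-triangles {i} {j} {k} {k′} k≢k′ = begin
    triangles i j k ⊗ triangles i j k′
      ≡⟨ ∑³-*-∑³ (λ a b c → e i a b ⊗ (e j b c ⊗ e k a c)) (λ a b c → e i a b ⊗ (e j b c ⊗ e k′ a c)) ⟩
    ∑³ (λ a b c → ∑³ λ a′ b′ c′ → (e i a b ⊗ (e j b c ⊗ e k a c)) ⊗ (e i a′ b′ ⊗ (e j b′ c′ ⊗ e k′ a′ c′)))
      ≤⟨ ∑³-mono (λ a b c → ∑³-mono (bad-triple k≢k′ a b c)) ⟩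
    ∑³ (λ a b c → ∑³ λ a′ b′ c′ → bad a b a′ b′ ⊕ (bad b c b′ c′ ⊕ bad a c a′ c′))
      ≡⟨ ∑³-cong (λ a b c → trans (∑³-+ (λ a′ b′ c′ → bad a b a′ b′) (λ a′ b′ c′ → bad b c b′ c′ ⊕ bad a c a′ c′))
           (cong (∑³ (λ a′ b′ c′ → bad a b a′ b′) ⊕_) (∑³-+ (λ a′ b′ c′ → bad b c b′ c′) (λ a′ b′ c′ → bad a c a′ c′)))) ⟩
    ∑³ (λ a b c → F₁ a b c ⊕ (F₂ a b c ⊕ F₃ a b c))
      ≡⟨ trans (∑³-+ F₁ (λ a b c → F₂ a b c ⊕ F₃ a b c)) (cong₂ _⊕_ ∑⁶-bad₁₂ (trans (∑³-+ F₂ F₃) (cong₂ _⊕_ ∑⁶-bad₂₃ ∑⁶-bad₁₃))) ⟩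
    N² ⊗ ∑⁴ bad ⊕ (N² ⊗ ∑⁴ bad ⊕ N² ⊗ ∑⁴ bad)
      ≡⟨ thrice (N² ⊗ ∑⁴ bad) ⟩
    + 3 ⊗ (N² ⊗ ∑⁴ bad) ∎
    where
    open ≤-Reasoning
    F₁ F₂ F₃ : A → A → A → ℤ
    F₁ a b c = ∑³ λ a′ b′ c′ → bad a b a′ b′
    F₂ a b c = ∑³ λ a′ b′ c′ → bad b c b′ c′
    F₃ a b c = ∑³ λ a′ b′ c′ → bad a c a′ c′
    thrice : ∀ x → x ⊕ (x ⊕ x) ≡ + 3 ⊗ x
    thrice = solve-∀

  -- Density makes the colouring consistent and balanced

  module Stability (adj : A → A → A → A → Bool) (adj-swap : ∀ a b c d → adj a b c d ≡ adj a c b d)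
    (0<S : 0ℤ <ᶻ S) (E : ℤ) (0≤E : 0ℤ ≤ᶻ E)
    (furedi : ∑⁴ (λ a b c d → ⟦ adj a b c d ⟧ ⊕ ⟦ adj a b c d ∧ (col a b == col c d) ⟧) ≤ᶻ
              ∑⁴ (λ a b c d → ⟦ not (col a b == col c d) ⟧))
    (dense : (S - 1ℤ) ⊗ E ⊗ N⁴ ≤ᶻ S ⊗ E ⊗ ∑⁴ (λ a b c d → ⟦ adj a b c d ⟧) ⊕ + 2 ⊗ S ⊗ N⁴) where

    same : A → A → A → A → Bool
    same a b c d = col a b == col c d

    D = ∑⁴ λ a b c d → ⟦ adj a b c d ⟧
    M = ∑⁴ λ a b c d → ⟦ adj a b c d ∧ same a b c d ⟧
    X = ∑⁴ λ a b c d → ⟦ not (same a b c d) ⟧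
    Y = ∑⁴ λ a b c d → ⟦ same a b c d ⟧

    ∑⁴-cong : ∀ {f g} → (∀ a b c d → f a b c d ≡ g a b c d) → ∑⁴ f ≡ ∑⁴ g
    ∑⁴-cong f≡g = ∑-cong V λ a → ∑³-cong (f≡g a)

    ∑⁴-mono : ∀ {f g} → (∀ a b c d → f a b c d ≤ᶻ g a b c d) → ∑⁴ f ≤ᶻ ∑⁴ g
    ∑⁴-mono f≤g = ∑-mono V λ a → ∑³-mono (f≤g a)

    0≤M : 0ℤ ≤ᶻ M
    0≤M = ∑-nonneg V λ a → ∑-nonneg V λ b → ∑-nonneg V λ c → ∑-nonneg V λ d → 0≤⟦⟧ (adj a b c d ∧ same a b c d)

    D+M≤X : D ⊕ M ≤ᶻ X
    D+M≤X = ≤-trans (≤-reflexive (sym (∑⁴-+ (λ a b c d → ⟦ adj a b c d ⟧) (λ a b c d → ⟦ adj a b c d ∧ same a b c d ⟧)))) furedi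

    Y+X : Y ⊕ X ≡ N⁴
    Y+X = begin
      Y ⊕ X                          ≡⟨ sym (∑⁴-+ (λ a b c d → ⟦ same a b c d ⟧) (λ a b c d → ⟦ not (same a b c d) ⟧)) ⟩
      ∑⁴ (λ a b c d → ⟦ same a b c d ⟧ ⊕ ⟦ not (same a b c d) ⟧)
                                     ≡⟨ ∑⁴-cong (λ a b c d → complement (same a b c d)) ⟩
      ∑⁴ (λ _ _ _ _ → 1ℤ)            ≡⟨ trans (∑²-cong λ _ _ → ∑²-const 1ℤ) (∑²-const (N ⊗ (N ⊗ 1ℤ))) ⟩
      N ⊗ (N ⊗ (N ⊗ (N ⊗ 1ℤ)))       ≡⟨ cong (λ t → N ⊗ (N ⊗ (N ⊗ t))) (*-identityʳ N) ⟩
      N⁴                             ∎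
      where
      open ≡-Reasoning
      complement : ∀ t → ⟦ t ⟧ ⊕ ⟦ not t ⟧ ≡ 1ℤ
      complement true  = refl
      complement false = refl

    ∑-m : ∑ Γ m ≡ N²
    ∑-m = trans (∑-swap Γ V (λ i a → p a i)) (trans (∑-cong V ∑-p) (∑V-const N))

    ∑-m² : ∑[ i ∈ Γ ] (m i ⊗ m i) ≡ Y
    ∑-m² = begin
      ∑[ i ∈ Γ ] (m i ⊗ m i)
        ≡⟨ ∑-cong Γ (λ i → trans (sym (∑²-*ˡ (m i) (e i))) (∑²-cong λ a b → trans (*-comm (m i) (e i a b)) (sym (∑²-*ˡ (e i a b) (e i))))) ⟩
      ∑[ i ∈ Γ ] ∑⁴ (λ a b c d → e i a b ⊗ e i c d)
        ≡⟨ trans (∑-swap Γ V (λ i a → ∑³ λ b c d → e i a b ⊗ e i c d)) (∑-cong V λ a →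
             trans (∑-swap Γ V (λ i b → ∑² λ c d → e i a b ⊗ e i c d)) (∑-cong V λ b →
             trans (∑-swap Γ V (λ i c → ∑[ d ∈ V ] (e i a b ⊗ e i c d))) (∑-cong V λ c →
             ∑-swap Γ V (λ i d → e i a b ⊗ e i c d)))) ⟩
      ∑⁴ (λ a b c d → ∑[ i ∈ Γ ] (e i a b ⊗ e i c d))
        ≡⟨ ∑⁴-cong (λ a b c d → trans (∑-e a b (λ i → e i c d)) (cong ⟦_⟧ (==-sym (col c d) (col a b)))) ⟩
      Y ∎
      where open ≡-Reasoning

    total-excess≡ : total-excess ≡ S ⊗ (S ⊗ Y - N⁴)
    total-excess≡ = begin
      ∑[ i ∈ Γ ] (excess i ⊗ excess i)
        ≡⟨ ∑-cong Γ (λ i → expand S N² (m i)) ⟩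
      ∑[ i ∈ Γ ] ((S ⊗ S ⊗ (m i ⊗ m i) ⊕ N² ⊗ N²) - + 2 ⊗ S ⊗ N² ⊗ m i)
        ≡⟨ trans (∑-- Γ (λ i → S ⊗ S ⊗ (m i ⊗ m i) ⊕ N² ⊗ N²) (λ i → + 2 ⊗ S ⊗ N² ⊗ m i))
             (cong₂ _-_ (trans (∑-+ Γ (λ i → S ⊗ S ⊗ (m i ⊗ m i)) (λ _ → N² ⊗ N²))
                          (cong₂ _⊕_ (trans (∑-*ˡ Γ (S ⊗ S) (λ i → m i ⊗ m i)) (cong (S ⊗ S ⊗_) ∑-m²)) (∑Γ-const (N² ⊗ N²))))
                        (trans (∑-*ˡ Γ (+ 2 ⊗ S ⊗ N²) m) (cong (+ 2 ⊗ S ⊗ N² ⊗_) ∑-m))) ⟩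
      (S ⊗ S ⊗ Y ⊕ S ⊗ (N² ⊗ N²)) - + 2 ⊗ S ⊗ N² ⊗ N²
        ≡⟨ collect S N Y ⟩
      S ⊗ (S ⊗ Y - N⁴) ∎
      where
      open ≡-Reasoning
      expand : ∀ s n x → (s ⊗ x - n) ⊗ (s ⊗ x - n) ≡ (s ⊗ s ⊗ (x ⊗ x) ⊕ n ⊗ n) - + 2 ⊗ s ⊗ n ⊗ x
      expand = solve-∀
      collect : ∀ s n y → (s ⊗ s ⊗ y ⊕ s ⊗ ((n ⊗ n) ⊗ (n ⊗ n))) - + 2 ⊗ s ⊗ (n ⊗ n) ⊗ (n ⊗ n) ≡ s ⊗ (s ⊗ y - n ⊗ (n ⊗ (n ⊗ n)))
      collect = solve-∀

    cancel-S : ∀ {x y} → S ⊗ x ≤ᶻ S ⊗ y → x ≤ᶻ y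
    cancel-S {x} {y} = *-cancelˡ-≤-pos x y S {{positive 0<S}}

    N⁴≤SY : N⁴ ≤ᶻ S ⊗ Y
    N⁴≤SY = 0≤i-j⇒j≤i (cancel-S (begin
      S ⊗ 0ℤ              ≡⟨ *-zeroʳ S ⟩
      0ℤ                  ≤⟨ ∑-nonneg Γ (λ i → 0≤x² (excess i)) ⟩
      total-excess        ≡⟨ total-excess≡ ⟩
      S ⊗ (S ⊗ Y - N⁴)    ∎))
      where open ≤-Reasoning

    -- Imbalance is the excess of `Y` over its minimum `N⁴/S`. As `Y = N⁴ - X` and `X ≥ D`, density
    -- leaves an excess of at most `2N⁴/E`.
    balanced : E ⊗ total-excess ≤ᶻ + 2 ⊗ (S ⊗ S) ⊗ N⁴
    balanced = ≤-trans (≤-reflexive (cong (E ⊗_) total-excess≡)) (≤-by-difference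
      (0≤-* 0≤S (0≤-+ (i≤j⇒0≤j-i dense) (0≤-* (0≤-* 0≤S 0≤E) (0≤-+ (i≤j⇒0≤j-i D+M≤X) 0≤M))))
      (trans (cong (λ t → + 2 ⊗ (S ⊗ S) ⊗ t - E ⊗ (S ⊗ (S ⊗ Y - t))) (sym Y+X))
        (trans (identity S E X Y D M) (cong (λ t → S ⊗ ((S ⊗ E ⊗ D ⊕ + 2 ⊗ S ⊗ t - (S - 1ℤ) ⊗ E ⊗ t) ⊕ S ⊗ E ⊗ ((X - (D ⊕ M)) ⊕ M))) Y+X))))
      where
      identity : ∀ s E x y d m → + 2 ⊗ (s ⊗ s) ⊗ (y ⊕ x) - E ⊗ (s ⊗ (s ⊗ y - (y ⊕ x))) ≡
        s ⊗ ((s ⊗ E ⊗ d ⊕ + 2 ⊗ s ⊗ (y ⊕ x) - (s - 1ℤ) ⊗ E ⊗ (y ⊕ x)) ⊕ s ⊗ E ⊗ ((x - (d ⊕ m)) ⊕ m))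
      identity = solve-∀

    mismatch : A → A → A → A → ℤ
    mismatch a b c d = ⟦ adj a b c d xor not (same a b c d) ⟧

    ∑-mismatch : ∑⁴ mismatch ≡ (M ⊕ M) ⊕ (X - D)
    ∑-mismatch = begin
      ∑⁴ mismatch
        ≡⟨ ∑⁴-cong (λ a b c d → cases (adj a b c d) (same a b c d)) ⟩
      ∑⁴ (λ a b c d → (m′ a b c d ⊕ m′ a b c d) ⊕ (x′ a b c d - d′ a b c d))
        ≡⟨ trans (∑⁴-+ (λ a b c d → m′ a b c d ⊕ m′ a b c d) (λ a b c d → x′ a b c d - d′ a b c d))
                 (cong₂ _⊕_ (∑⁴-+ m′ m′) (∑⁴-- x′ d′)) ⟩
      (M ⊕ M) ⊕ (X - D) ∎
      where
      open ≡-Reasoning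
      m′ x′ d′ : A → A → A → A → ℤ
      m′ a b c d = ⟦ adj a b c d ∧ same a b c d ⟧
      x′ a b c d = ⟦ not (same a b c d) ⟧
      d′ a b c d = ⟦ adj a b c d ⟧
      cases : ∀ u v → ⟦ u xor not v ⟧ ≡ (⟦ u ∧ v ⟧ ⊕ ⟦ u ∧ v ⟧) ⊕ (⟦ not v ⟧ - ⟦ u ⟧)
      cases true  true  = refl
      cases true  false = refl
      cases false true  = refl
      cases false false = refl

    -- Adjacency does not depend on the splitting. If it coincides with difference of colours for
    -- both `ab|cd` and `ac|bd`, the two equalities of colours hold or fail together.
    bad≤mismatches : ∀ a b c d → bad a b c d ≤ᶻ mismatch a b c d ⊕ mismatch a c b d
    bad≤mismatches a b c d rewrite sym (adj-swap a b c d) = cases (adj a b c d) (same a b c d) (same a c b d)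
      where
      cases : ∀ u v w → ⟦ v xor w ⟧ ≤ᶻ ⟦ u xor not v ⟧ ⊕ ⟦ u xor not w ⟧
      cases u     true  true  = 0≤-+ (0≤⟦⟧ (u xor false)) (0≤⟦⟧ (u xor false))
      cases u     false false = 0≤-+ (0≤⟦⟧ (u xor true)) (0≤⟦⟧ (u xor true))
      cases true  true  false = ≤-refl
      cases true  false true  = ≤-refl
      cases false true  false = ≤-refl
      cases false false true  = ≤-refl

    -- Since `X ≤ N⁴ - N⁴/S`, density gives `X - D ≤ 2N⁴/E`, and so `M ≤ 2N⁴/E`. Mismatches number
    -- `2M + (X - D) ≤ 6N⁴/E`, and a bad tuple is charged to one of two mismatches: hence 12.
    few-bad : E ⊗ ∑⁴ bad ≤ᶻ + 12 ⊗ N⁴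
    few-bad = cancel-S (begin
      S ⊗ (E ⊗ ∑⁴ bad)
        ≤⟨ *-monoˡ 0≤S (*-monoˡ 0≤E (∑⁴-mono bad≤mismatches)) ⟩
      S ⊗ (E ⊗ ∑⁴ (λ a b c d → mismatch a b c d ⊕ mismatch a c b d))
        ≡⟨ cong (λ t → S ⊗ (E ⊗ t)) (trans (∑⁴-+ mismatch (λ a b c d → mismatch a c b d))
             (cong (∑⁴ mismatch ⊕_) (∑-cong V λ a → ∑-swap V V (λ b c → ∑[ d ∈ V ] mismatch a c b d)))) ⟩
      S ⊗ (E ⊗ (∑⁴ mismatch ⊕ ∑⁴ mismatch))
        ≡⟨ cong (λ t → S ⊗ (E ⊗ (t ⊕ t))) ∑-mismatch ⟩
      S ⊗ (E ⊗ (((M ⊕ M) ⊕ (X - D)) ⊕ ((M ⊕ M) ⊕ (X - D))))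
        ≤⟨ ≤-by-difference (0≤-+ (0≤-* {+ 6} 0≤+ (i≤j⇒0≤j-i dense))
             (0≤-+ (0≤-* (0≤-* (0≤-* {+ 4} 0≤+ 0≤S) 0≤E) (i≤j⇒0≤j-i D+M≤X)) (0≤-* (0≤-* {+ 6} 0≤+ 0≤E) (i≤j⇒0≤j-i N⁴≤SY))))
           (trans (cong (λ t → S ⊗ (+ 12 ⊗ t) - S ⊗ (E ⊗ (((M ⊕ M) ⊕ (X - D)) ⊕ ((M ⊕ M) ⊕ (X - D))))) (sym Y+X))
             (trans (identity S E X Y D M) (cong (λ t → + 6 ⊗ (S ⊗ E ⊗ D ⊕ + 2 ⊗ S ⊗ t - (S - 1ℤ) ⊗ E ⊗ t) ⊕
               (+ 4 ⊗ S ⊗ E ⊗ (X - (D ⊕ M)) ⊕ + 6 ⊗ E ⊗ (S ⊗ Y - t))) Y+X))) ⟩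
      S ⊗ (+ 12 ⊗ N⁴) ∎)
      where
      open ≤-Reasoning
      identity : ∀ s E x y d m → s ⊗ (+ 12 ⊗ (y ⊕ x)) - s ⊗ (E ⊗ (((m ⊕ m) ⊕ (x - d)) ⊕ ((m ⊕ m) ⊕ (x - d)))) ≡
        + 6 ⊗ (s ⊗ E ⊗ d ⊕ + 2 ⊗ s ⊗ (y ⊕ x) - (s - 1ℤ) ⊗ E ⊗ (y ⊕ x)) ⊕
        (+ 4 ⊗ s ⊗ E ⊗ (x - (d ⊕ m)) ⊕ + 6 ⊗ E ⊗ (s ⊗ y - (y ⊕ x)))
      identity = solve-∀

  -- The constant 147456 = 64² · 3 · 12 is what Related-unique requires.
  module Associativity (0<N : 0ℤ <ᶻ N) (1≤S : 1ℤ ≤ᶻ S) (E : ℤ)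
    (L : ℤ) (L≡ : L ≡ + 147456)
    (E-large : L ⊗ ((S ⊗ S ⊗ S ⊗ S ⊗ S ⊗ S) ⊗ (S ⊗ S ⊗ S ⊗ S ⊗ S ⊗ S)) <ᶻ E)
    (few-bad : E ⊗ ∑⁴ bad ≤ᶻ + 12 ⊗ N⁴)
    (balanced : E ⊗ total-excess ≤ᶻ + 2 ⊗ (S ⊗ S) ⊗ N⁴) where

    S² = S ⊗ S
    S⁶ = S ⊗ S ⊗ S ⊗ S ⊗ S ⊗ S
    -- At most 4S³N⁴/K of the 4-tuples contain a triangle with unrelated colours, which is less than
    -- the number N⁴/(8S³) of paths guaranteed for any three colours.
    K = + 64 ⊗ S⁶

    0≤S² : 0ℤ ≤ᶻ S²
    0≤S² = 0≤x² S

    1≤S² : 1ℤ ≤ᶻ S²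
    1≤S² = *-mono {1ℤ} {S} {1ℤ} {S} 0≤+ 0≤+ 1≤S 1≤S

    S²≤S⁶ : S² ≤ᶻ S⁶
    S²≤S⁶ = begin
      S²                     ≡⟨ sym (*-identityʳ S²) ⟩
      S² ⊗ 1ℤ                ≤⟨ *-monoˡ 0≤S² (*-mono {1ℤ} {S²} {1ℤ} {S²} 0≤+ 0≤+ 1≤S² 1≤S²) ⟩
      S² ⊗ (S² ⊗ S²)         ≡⟨ regroup S ⟩
      S⁶                     ∎
      where
      open ≤-Reasoning
      regroup : ∀ s → (s ⊗ s) ⊗ ((s ⊗ s) ⊗ (s ⊗ s)) ≡ s ⊗ s ⊗ s ⊗ s ⊗ s ⊗ s
      regroup = solve-∀

    0≤S⁶ : 0ℤ ≤ᶻ S⁶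
    0≤S⁶ = ≤-trans 0≤S² S²≤S⁶

    1≤S⁶ : 1ℤ ≤ᶻ S⁶
    1≤S⁶ = ≤-trans 1≤S² S²≤S⁶

    0≤K : 0ℤ ≤ᶻ K
    0≤K = 0≤-* {+ 64} 0≤+ 0≤S⁶

    0≤L : 0ℤ ≤ᶻ L
    0≤L = subst (0ℤ ≤ᶻ_) (sym L≡) 0≤+

    S⁶≤E : ∀ {k} → k ≤ᶻ L → k ⊗ S⁶ ≤ᶻ E
    S⁶≤E {k} k≤L = begin
      k ⊗ S⁶               ≡⟨ *-comm k S⁶ ⟩
      S⁶ ⊗ k               ≤⟨ *-monoˡ 0≤S⁶ k≤L ⟩
      S⁶ ⊗ L               ≡⟨ *-comm S⁶ L ⟩
      L ⊗ S⁶               ≡⟨ cong (L ⊗_) (sym (*-identityʳ S⁶)) ⟩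
      L ⊗ (S⁶ ⊗ 1ℤ)        ≤⟨ *-monoˡ 0≤L (*-monoˡ 0≤S⁶ 1≤S⁶) ⟩
      L ⊗ (S⁶ ⊗ S⁶)        <⟨ E-large ⟩
      E                    ∎
      where open ≤-Reasoning

    0<E : 0ℤ <ᶻ E
    0<E = ≤-<-trans (0≤-* 0≤L (0≤x² S⁶)) E-large

    cancel-E : ∀ {x y} → E ⊗ x ≤ᶻ E ⊗ y → x ≤ᶻ y
    cancel-E {x} {y} = *-cancelˡ-≤-pos x y E {{positive 0<E}}

    0≤N² : 0ℤ ≤ᶻ N²
    0≤N² = 0≤x² N

    0≤N³ : 0ℤ ≤ᶻ N³
    0≤N³ = 0≤-* 0≤N 0≤N²

    dots-small : E ⊗ ∑² (λ a d → dot a d ⊗ dot a d) ≤ᶻ + 28 ⊗ (S² ⊗ S²) ⊗ (N² ⊗ N⁴)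
    dots-small = begin
      E ⊗ ∑² (λ a d → dot a d ⊗ dot a d)
        ≤⟨ *-monoˡ (<⇒≤ 0<E) ∑-dot² ⟩
      E ⊗ ((+ 2 ⊗ S ⊗ S) ⊗ (S ⊗ S ⊗ N² ⊗ ∑⁴ bad ⊕ N² ⊗ total-excess))
        ≡⟨ distribute (+ 2) E S N² (∑⁴ bad) total-excess ⟩
      (+ 2 ⊗ S²) ⊗ (S² ⊗ N² ⊗ (E ⊗ ∑⁴ bad) ⊕ N² ⊗ (E ⊗ total-excess))
        ≤⟨ *-monoˡ (0≤-* {+ 2} 0≤+ 0≤S²) (+-mono-≤ (*-monoˡ (0≤-* 0≤S² 0≤N²) few-bad) (*-monoˡ 0≤N² balanced)) ⟩
      (+ 2 ⊗ S²) ⊗ (S² ⊗ N² ⊗ (+ 12 ⊗ N⁴) ⊕ N² ⊗ (+ 2 ⊗ (S ⊗ S) ⊗ N⁴))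
        ≡⟨ collect (+ 2) (+ 12) (+ 2) S² N² N⁴ ⟩
      -- `28 = 2 · 12 + 2 · 2`, from the bad tuples and from the imbalance.
      + 28 ⊗ (S² ⊗ S²) ⊗ (N² ⊗ N⁴) ∎
      where
      open ≤-Reasoning
      distribute : ∀ c E s n b x → E ⊗ ((c ⊗ s ⊗ s) ⊗ (s ⊗ s ⊗ n ⊗ b ⊕ n ⊗ x)) ≡ (c ⊗ (s ⊗ s)) ⊗ ((s ⊗ s) ⊗ n ⊗ (E ⊗ b) ⊕ n ⊗ (E ⊗ x))
      distribute = solve-∀
      collect : ∀ c d f s n q → (c ⊗ s) ⊗ (s ⊗ n ⊗ (d ⊗ q) ⊕ n ⊗ (f ⊗ s ⊗ q)) ≡ (c ⊗ d ⊕ c ⊗ f) ⊗ (s ⊗ s) ⊗ (n ⊗ q)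
      collect = solve-∀

    -- The factor 24 makes the error term of `∑-path-≥` at most `N⁴/(4S)`, half of the lower bound
    -- `N⁴/(2S)` that `colour-frequent` gives for its main term.
    square-mass-small : ∀ i → + 24 ⊗ S ⊗ square-mass i ≤ᶻ N³
    square-mass-small i = ²-cancel-≤ 0≤N³ (cancel-E (begin
      E ⊗ ((+ 24 ⊗ S ⊗ W) ⊗ (+ 24 ⊗ S ⊗ W))
        ≡⟨ pull (+ 24) E S W ⟩
      (+ 576 ⊗ S²) ⊗ (E ⊗ (W ⊗ W))
        ≤⟨ *-monoˡ (0≤-* {+ 576} 0≤+ 0≤S²) (≤-trans (*-monoˡ (<⇒≤ 0<E) (square-mass²≤ i)) dots-small) ⟩
      (+ 576 ⊗ S²) ⊗ (+ 28 ⊗ (S² ⊗ S²) ⊗ (N² ⊗ N⁴))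
        ≡⟨ regroup (+ 576) (+ 28) S N ⟩
      (N³ ⊗ N³) ⊗ (+ 16128 ⊗ S⁶)
        ≤⟨ *-monoˡ (0≤x² N³) (S⁶≤E {+ 16128} (subst (+ 16128 ≤ᶻ_) (sym L≡) (+≤+ (ℕ.≤ᵇ⇒≤ 16128 147456 _)))) ⟩
      (N³ ⊗ N³) ⊗ E
        ≡⟨ *-comm (N³ ⊗ N³) E ⟩
      E ⊗ (N³ ⊗ N³) ∎))
      where
      open ≤-Reasoning
      W = square-mass i
      pull : ∀ c E s x → E ⊗ ((c ⊗ s ⊗ x) ⊗ (c ⊗ s ⊗ x)) ≡ ((c ⊗ c) ⊗ (s ⊗ s)) ⊗ (E ⊗ (x ⊗ x))
      pull = solve-∀
      regroup : ∀ c d s n → (c ⊗ (s ⊗ s)) ⊗ (d ⊗ ((s ⊗ s) ⊗ (s ⊗ s)) ⊗ ((n ⊗ n) ⊗ (n ⊗ (n ⊗ (n ⊗ n))))) ≡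
                            ((n ⊗ (n ⊗ n)) ⊗ (n ⊗ (n ⊗ n))) ⊗ ((c ⊗ d) ⊗ (s ⊗ s ⊗ s ⊗ s ⊗ s ⊗ s))
      regroup = solve-∀

    colour-frequent : ∀ j → N² ≤ᶻ + 2 ⊗ S ⊗ m j
    colour-frequent j = ≤-by-difference (i≤j⇒0≤j-i half) (double (N²) (S) (m j))
      where
      open ≤-Reasoning
      double : ∀ n s x → + 2 ⊗ s ⊗ x - n ≡ n - + 2 ⊗ (n - s ⊗ x)
      double = solve-∀
      pull : ∀ E n s x → E ⊗ ((+ 2 ⊗ (n - s ⊗ x)) ⊗ (+ 2 ⊗ (n - s ⊗ x))) ≡ + 4 ⊗ (E ⊗ ((s ⊗ x - n) ⊗ (s ⊗ x - n)))
      pull = solve-∀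
      regroup : ∀ c d s n → c ⊗ (d ⊗ s ⊗ (n ⊗ (n ⊗ (n ⊗ n)))) ≡ ((n ⊗ n) ⊗ (n ⊗ n)) ⊗ ((c ⊗ d) ⊗ s)
      regroup = solve-∀
      half : + 2 ⊗ (N² - S ⊗ m j) ≤ᶻ N²
      half = ²-cancel-≤ 0≤N² (cancel-E (begin
        E ⊗ ((+ 2 ⊗ (N² - S ⊗ m j)) ⊗ (+ 2 ⊗ (N² - S ⊗ m j)))
          ≡⟨ pull E N² S (m j) ⟩
        + 4 ⊗ (E ⊗ (excess j ⊗ excess j))
          ≤⟨ *-monoˡ {+ 4} 0≤+ (≤-trans (*-monoˡ (<⇒≤ 0<E) (term≤∑ (λ i → 0≤x² (excess i)) (∈-allFin j))) balanced) ⟩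
        + 4 ⊗ (+ 2 ⊗ S² ⊗ N⁴)
          ≡⟨ regroup (+ 4) (+ 2) S² N ⟩
        (N² ⊗ N²) ⊗ (+ 8 ⊗ S²)
          ≤⟨ *-monoˡ (0≤x² N²) (≤-trans (*-monoˡ {+ 8} 0≤+ S²≤S⁶) (S⁶≤E {+ 8} (subst (+ 8 ≤ᶻ_) (sym L≡) (+≤+ (ℕ.≤ᵇ⇒≤ 8 147456 _))))) ⟩
        (N² ⊗ N²) ⊗ E
          ≡⟨ *-comm (N² ⊗ N²) E ⟩
        E ⊗ (N² ⊗ N²) ∎))

    many-paths : ∀ i j k → + 2 ⊗ N⁴ ≤ᶻ + 16 ⊗ S ⊗ S ⊗ S ⊗ ∑⁴ (path i j k)
    many-paths i j k = ≤-by-difference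
      (0≤-+ (0≤-* (0≤-* {+ 8} 0≤+ 0≤S) (i≤j⇒0≤j-i (∑-path-≥ i j k)))
        (0≤-+ (0≤-* (0≤-* {+ 4} 0≤+ 0≤N²) (i≤j⇒0≤j-i (colour-frequent j)))
          (0≤-* 0≤N (0≤-+ (i≤j⇒0≤j-i (square-mass-small i)) (i≤j⇒0≤j-i (square-mass-small k))))))
      (combine S N (m j) (square-mass i) (square-mass k) (∑⁴ (path i j k)))
      where
      combine : ∀ s n μ x y P → + 16 ⊗ s ⊗ s ⊗ s ⊗ P - + 2 ⊗ (n ⊗ (n ⊗ (n ⊗ n))) ≡
        (+ 8 ⊗ s) ⊗ ((+ 2 ⊗ s ⊗ s) ⊗ P - (n ⊗ n ⊗ μ - + 3 ⊗ (n ⊗ (x ⊕ y)))) ⊕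
        ((+ 4 ⊗ (n ⊗ n)) ⊗ (+ 2 ⊗ s ⊗ μ - n ⊗ n) ⊕
         n ⊗ ((n ⊗ (n ⊗ n) - + 24 ⊗ s ⊗ x) ⊕ (n ⊗ (n ⊗ n) - + 24 ⊗ s ⊗ y)))
      combine = solve-∀

    -- The composition of colours

    Related : Fin s → Fin s → Fin s → Set
    Related i j k = N³ ≤ᶻ K ⊗ triangles i j k

    related : Fin s → Fin s → Fin s → Bool
    related i j k = does (N³ ≤? K ⊗ triangles i j k)

    related-sound : ∀ {i j k} → related i j k ≡ true → Related i j k
    related-sound {i} {j} {k} eq with N³ ≤? K ⊗ triangles i j k
    ... | yes r = r
    related-sound () | no _

    Related-swap₁₂ : ∀ {i j k} → Related i j k → Related j i k
    Related-swap₁₂ {i} {j} {k} = subst (λ t → N³ ≤ᶻ K ⊗ t) (triangles-swap₁₂ i j k)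

    Related-swap₂₃ : ∀ {i j k} → Related i j k → Related i k j
    Related-swap₂₃ {i} {j} {k} = subst (λ t → N³ ≤ᶻ K ⊗ t) (triangles-swap₂₃ i j k)

    0<N³ : 0ℤ <ᶻ N³
    0<N³ = positive-* 0<N (positive-* 0<N 0<N)

    -- Two accepted patterns supply at least `N⁶/K²` pairs of triangles, but there are at most
    -- `3 · N² · 12N⁴/E` of them, which would force `E ≤ 36K²`.
    Related-unique : ∀ {i j k k′} → Related i j k → Related i j k′ → k ≡ k′
    Related-unique {i} {j} {k} {k′} r r′ with k ≟ k′
    ... | yes k≡k′ = k≡k′
    ... | no  k≢k′ = ⊥-elim (<-irrefl refl (begin-strict
      E ⊗ (N³ ⊗ N³)
        ≤⟨ *-monoˡ (<⇒≤ 0<E) (*-mono 0≤N³ 0≤N³ r r′) ⟩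
      E ⊗ ((K ⊗ triangles i j k) ⊗ (K ⊗ triangles i j k′))
        ≡⟨ cong (E ⊗_) (pull K (triangles i j k) (triangles i j k′)) ⟩
      E ⊗ (K ⊗ K ⊗ (triangles i j k ⊗ triangles i j k′))
        ≤⟨ *-monoˡ (<⇒≤ 0<E) (*-monoˡ (0≤x² K) (triangles-*-triangles k≢k′)) ⟩
      E ⊗ (K ⊗ K ⊗ (+ 3 ⊗ (N² ⊗ ∑⁴ bad)))
        ≡⟨ commute (+ 3) E (K ⊗ K) N² (∑⁴ bad) ⟩
      (K ⊗ K) ⊗ (+ 3 ⊗ N²) ⊗ (E ⊗ ∑⁴ bad)
        ≤⟨ *-monoˡ (0≤-* (0≤x² K) (0≤-* {+ 3} 0≤+ 0≤N²)) few-bad ⟩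
      (K ⊗ K) ⊗ (+ 3 ⊗ N²) ⊗ (+ 12 ⊗ N⁴)
        ≡⟨ regroup (+ 64) (+ 3) (+ 12) S⁶ N ⟩
      (N³ ⊗ N³) ⊗ (+ 147456 ⊗ (S⁶ ⊗ S⁶))
        ≡⟨ cong (λ l → (N³ ⊗ N³) ⊗ (l ⊗ (S⁶ ⊗ S⁶))) (sym L≡) ⟩
      (N³ ⊗ N³) ⊗ (L ⊗ (S⁶ ⊗ S⁶))
        <⟨ *-monoˡ-<-pos (N³ ⊗ N³) {{positive (positive-* 0<N³ 0<N³)}} E-large ⟩
      (N³ ⊗ N³) ⊗ E
        ≡⟨ *-comm (N³ ⊗ N³) E ⟩
      E ⊗ (N³ ⊗ N³) ∎))
      where
      open ≤-Reasoning
      pull : ∀ k x y → (k ⊗ x) ⊗ (k ⊗ y) ≡ k ⊗ k ⊗ (x ⊗ y)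
      pull = solve-∀
      commute : ∀ c E k n b → E ⊗ (k ⊗ (c ⊗ (n ⊗ b))) ≡ k ⊗ (c ⊗ n) ⊗ (E ⊗ b)
      commute = solve-∀
      regroup : ∀ c d f s n → ((c ⊗ s) ⊗ (c ⊗ s)) ⊗ (d ⊗ (n ⊗ n)) ⊗ (f ⊗ (n ⊗ (n ⊗ (n ⊗ n)))) ≡
        ((n ⊗ (n ⊗ n)) ⊗ (n ⊗ (n ⊗ n))) ⊗ ((c ⊗ c ⊗ d ⊗ f) ⊗ (s ⊗ s))
      regroup = solve-∀

    unrelated : A → A → A → ℤ
    unrelated a b c = ⟦ not (related (col a b) (col b c) (col a c)) ⟧

    -- There are at most `S³` rejected patterns, each with fewer than `N³/K` triangles.
    few-unrelated : K ⊗ ∑³ unrelated ≤ᶻ S ⊗ (S ⊗ (S ⊗ N³))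
    few-unrelated = begin
      K ⊗ ∑³ unrelated
        ≡⟨ cong (K ⊗_) by-colours ⟩
      K ⊗ (∑[ i ∈ Γ ] ∑[ j ∈ Γ ] ∑[ k ∈ Γ ] (triangles i j k ⊗ g i j k))
        ≡⟨ trans (sym (∑-*ˡ Γ K (λ i → ∑[ j ∈ Γ ] ∑[ k ∈ Γ ] (triangles i j k ⊗ g i j k)))) (∑-cong Γ λ i →
             trans (sym (∑-*ˡ Γ K (λ j → ∑[ k ∈ Γ ] (triangles i j k ⊗ g i j k)))) (∑-cong Γ λ j →
             sym (∑-*ˡ Γ K (λ k → triangles i j k ⊗ g i j k)))) ⟩
      ∑[ i ∈ Γ ] ∑[ j ∈ Γ ] ∑[ k ∈ Γ ] (K ⊗ (triangles i j k ⊗ g i j k))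
        ≤⟨ ∑-mono Γ (λ i → ∑-mono Γ λ j → ∑-mono Γ λ k → pointwise i j k) ⟩
      ∑[ i ∈ Γ ] ∑[ j ∈ Γ ] ∑[ k ∈ Γ ] N³
        ≡⟨ trans (∑-cong Γ λ i → trans (∑-cong Γ λ j → ∑Γ-const N³) (∑Γ-const (S ⊗ N³))) (∑Γ-const (S ⊗ (S ⊗ N³))) ⟩
      S ⊗ (S ⊗ (S ⊗ N³)) ∎
      where
      open ≤-Reasoning
      g : Fin s → Fin s → Fin s → ℤ
      g i j k = ⟦ not (related i j k) ⟧
      pointwise : ∀ i j k → K ⊗ (triangles i j k ⊗ g i j k) ≤ᶻ N³
      pointwise i j k with N³ ≤? K ⊗ triangles i j k
      ... | yes _ = ≤-trans (≤-reflexive (trans (cong (K ⊗_) (*-zeroʳ (triangles i j k))) (*-zeroʳ K))) 0≤N³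
      ... | no ¬r = ≤-trans (≤-reflexive (cong (K ⊗_) (*-identityʳ (triangles i j k)))) (<⇒≤ (≰⇒> ¬r))
      t : Fin s → Fin s → Fin s → A → A → A → ℤ
      t i j k a b c = e i a b ⊗ (e j b c ⊗ e k a c) ⊗ g i j k
      at : ∀ a b c → unrelated a b c ≡ ∑[ i ∈ Γ ] ∑[ j ∈ Γ ] ∑[ k ∈ Γ ] t i j k a b c
      at a b c = sym (trans (∑-cong Γ λ i → trans (∑-cong Γ λ j → trans (∑-cong Γ λ k → assoc³ (e i a b) (e j b c) (e k a c) (g i j k))
          (trans (∑-*ˡ Γ (e i a b) (λ k → e j b c ⊗ (e k a c ⊗ g i j k)))
            (cong (e i a b ⊗_) (trans (∑-*ˡ Γ (e j b c) (λ k → e k a c ⊗ g i j k)) (cong (e j b c ⊗_) (∑-e a c (g i j)))))))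
          (trans (∑-*ˡ Γ (e i a b) (λ j → e j b c ⊗ g i j (col a c))) (cong (e i a b ⊗_) (∑-e b c (λ j → g i j (col a c))))))
          (∑-e a b (λ i → g i (col b c) (col a c))))
        where
        assoc³ : ∀ x y z u → x ⊗ (y ⊗ z) ⊗ u ≡ x ⊗ (y ⊗ (z ⊗ u))
        assoc³ = solve-∀
      ∑³-∑ : ∀ (h : A → A → A → Fin s → ℤ) → ∑³ (λ a b c → ∑ Γ (h a b c)) ≡ ∑[ i ∈ Γ ] ∑³ (λ a b c → h a b c i)
      ∑³-∑ h = trans (∑²-cong λ a b → ∑-swap V Γ (λ c i → h a b c i)) (trans (∑-cong V λ a → ∑-swap V Γ (λ b i → ∑[ c ∈ V ] h a b c i))
        (∑-swap V Γ (λ a i → ∑² λ b c → h a b c i)))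
      by-colours : ∑³ unrelated ≡ ∑[ i ∈ Γ ] ∑[ j ∈ Γ ] ∑[ k ∈ Γ ] (triangles i j k ⊗ g i j k)
      by-colours = trans (∑³-cong at) (trans (∑³-∑ (λ a b c i → ∑[ j ∈ Γ ] ∑[ k ∈ Γ ] t i j k a b c)) (∑-cong Γ λ i →
        trans (∑³-∑ (λ a b c j → ∑[ k ∈ Γ ] t i j k a b c)) (∑-cong Γ λ j →
        trans (∑³-∑ (λ a b c k → t i j k a b c)) (∑-cong Γ λ k →
        trans (∑³-cong λ a b c → *-comm (e i a b ⊗ (e j b c ⊗ e k a c)) (g i j k))
          (trans (∑³-*ˡ (g i j k) (λ a b c → e i a b ⊗ (e j b c ⊗ e k a c))) (*-comm (g i j k) (triangles i j k)))))))

    defects : A → A → A → A → ℤ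
    defects a b c d = (unrelated a b c ⊕ unrelated b c d) ⊕ (unrelated a c d ⊕ unrelated a b d)

    ∑-defects : ∑⁴ defects ≡ + 4 ⊗ (N ⊗ ∑³ unrelated)
    ∑-defects = begin
      ∑⁴ defects
        ≡⟨ trans (∑⁴-+ (λ a b c d → unrelated a b c ⊕ unrelated b c d) (λ a b c d → unrelated a c d ⊕ unrelated a b d))
             (cong₂ _⊕_ (∑⁴-+ (λ a b c d → unrelated a b c) (λ a b c d → unrelated b c d))
                        (∑⁴-+ (λ a b c d → unrelated a c d) (λ a b c d → unrelated a b d))) ⟩
      (∑⁴ (λ a b c d → unrelated a b c) ⊕ ∑⁴ (λ a b c d → unrelated b c d)) ⊕
      (∑⁴ (λ a b c d → unrelated a c d) ⊕ ∑⁴ (λ a b c d → unrelated a b d))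
        ≡⟨ cong₂ _⊕_
             (cong₂ _⊕_ (trans (∑³-cong λ a b c → ∑V-const (unrelated a b c)) (∑³-*ˡ N unrelated)) (∑V-const (∑³ unrelated)))
             (cong₂ _⊕_ (trans (∑-cong V λ a → ∑V-const (∑² (unrelated a))) (∑-*ˡ V N (λ a → ∑² (unrelated a))))
                        (trans (∑²-cong λ a b → ∑V-const (∑ V (unrelated a b))) (∑²-*ˡ N (λ a b → ∑ V (unrelated a b))))) ⟩
      (U ⊕ U) ⊕ (U ⊕ U)
        ≡⟨ quadruple U ⟩
      + 4 ⊗ U ∎
      where
      open ≡-Reasoning
      U = N ⊗ ∑³ unrelated
      quadruple : ∀ x → (x ⊕ x) ⊕ (x ⊕ x) ≡ + 4 ⊗ x
      quadruple = solve-∀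

    0≤unrelated : ∀ a b c → 0ℤ ≤ᶻ unrelated a b c
    0≤unrelated a b c = 0≤⟦⟧ (not (related (col a b) (col b c) (col a c)))

    -- An indicator less a count: it is positive only if the path has colours `i`, `j`, `k` and all
    -- four triangles of the tuple are related.
    surplus : Fin s → Fin s → Fin s → A → A → A → A → ℤ
    surplus i j k a b c d = path i j k a b c d - defects a b c d

    0<∑-surplus : ∀ i j k → 0ℤ <ᶻ ∑⁴ (surplus i j k)
    0<∑-surplus i j k = *-cancelˡ-<-nonNeg (K ⊗ Q) {{nonNegative (0≤-* 0≤K 0≤Q)}} (begin-strict
      K ⊗ Q ⊗ 0ℤ                    ≡⟨ *-zeroʳ (K ⊗ Q) ⟩
      0ℤ                            <⟨ positive-* (<-≤-trans 0<64 64≤K) (positive-* 0<N 0<N³) ⟩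
      -- After multiplication by `Q` the paths contribute at least `2N⁴` and the defects at most
      -- `N⁴`.
      K ⊗ N⁴                        ≤⟨ ≤-by-difference (0≤-+ (0≤-* 0≤K (i≤j⇒0≤j-i (many-paths i j k))) (i≤j⇒0≤j-i few-defects))
                                         (split K Q N⁴ (∑⁴ (path i j k)) (∑⁴ defects)) ⟩
      K ⊗ Q ⊗ (∑⁴ (path i j k) - ∑⁴ defects)
                                    ≡⟨ cong (K ⊗ Q ⊗_) (sym (∑⁴-- (path i j k) defects)) ⟩
      K ⊗ Q ⊗ ∑⁴ (surplus i j k)    ∎)
      where
      open ≤-Reasoning
      Q = + 16 ⊗ S ⊗ S ⊗ S
      0≤Q : 0ℤ ≤ᶻ Q
      0≤Q = 0≤-* (0≤-* (0≤-* {+ 16} 0≤+ 0≤S) 0≤S) 0≤S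
      0<64 : 0ℤ <ᶻ + 64
      0<64 = +<+ (ℕ.s≤s z≤n)
      64≤K : + 64 ≤ᶻ K
      64≤K = *-monoˡ {+ 64} 0≤+ 1≤S⁶
      split : ∀ k q n P D → k ⊗ q ⊗ (P - D) - k ⊗ n ≡ k ⊗ (q ⊗ P - + 2 ⊗ n) ⊕ (k ⊗ n - k ⊗ q ⊗ D)
      split = solve-∀
      few-defects : K ⊗ Q ⊗ ∑⁴ defects ≤ᶻ K ⊗ N⁴
      few-defects = begin
        K ⊗ Q ⊗ ∑⁴ defects                             ≡⟨ cong (K ⊗ Q ⊗_) ∑-defects ⟩
        K ⊗ Q ⊗ (+ 4 ⊗ (N ⊗ ∑³ unrelated))             ≡⟨ commute (+ 4) K Q N (∑³ unrelated) ⟩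
        (Q ⊗ (+ 4 ⊗ N)) ⊗ (K ⊗ ∑³ unrelated)           ≤⟨ *-monoˡ (0≤-* 0≤Q (0≤-* {+ 4} 0≤+ 0≤N)) few-unrelated ⟩
        (Q ⊗ (+ 4 ⊗ N)) ⊗ (S ⊗ (S ⊗ (S ⊗ N³)))         ≡⟨ regroup (+ 16) (+ 4) S N N³ ⟩
        K ⊗ N⁴                                         ∎
        where
        commute : ∀ c k q n u → k ⊗ q ⊗ (c ⊗ (n ⊗ u)) ≡ (q ⊗ (c ⊗ n)) ⊗ (k ⊗ u)
        commute = solve-∀
        regroup : ∀ c d s n m → (c ⊗ s ⊗ s ⊗ s ⊗ (d ⊗ n)) ⊗ (s ⊗ (s ⊗ (s ⊗ m))) ≡ ((c ⊗ d) ⊗ (s ⊗ s ⊗ s ⊗ s ⊗ s ⊗ s)) ⊗ (n ⊗ m)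
        regroup = solve-∀

    surplus-tuple : ∀ i j k → ∃[ a ] ∃[ b ] ∃[ c ] ∃[ d ] 0ℤ <ᶻ surplus i j k a b c d
    surplus-tuple i j k =
      let a , pa = ∑-positive⇒∃ V (0<∑-surplus i j k)
          b , pb = ∑-positive⇒∃ V pa
          c , pc = ∑-positive⇒∃ V pb
          d , pd = ∑-positive⇒∃ V pc
      in a , b , c , d , pd

    -- In a tuple of positive surplus let `x`, `y`, `z` be the colours of `ac`, `ad`, `bd`. The
    -- triangles `abc`, `acd` exhibit `y` as `(ij)k`, the triangles `bcd`, `abd` as `i(jk)`.
    associating : ∀ i j k → ∃[ x ] ∃[ y ] ∃[ z ] (Related i j x × Related x k y × Related j k z × Related i z y)
    associating i j k =
      let a , b , c , d , pos = surplus-tuple i j k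
          P = path i j k a b c d
          pos₁ , pos₂ = <-split {P} (0≤-+ (0≤unrelated a b c) (0≤unrelated b c d)) (0≤-+ (0≤unrelated a c d) (0≤unrelated a b d)) pos
          abc , bcd = <-split {P} (0≤unrelated a b c) (0≤unrelated b c d) pos₁
          acd , abd = <-split {P} (0≤unrelated a c d) (0≤unrelated a b d) pos₂
          ab≡i , bc≡j , cd≡k = colours (col a b) (col b c) (col c d) (<-drop {P} (0≤unrelated a b c) abc)
          P≤1 = path≤1 (col a b == i) (col b c == j) (col c d == k)
      in col a c , col a d , col b d ,
         subst₂ (λ i j → Related i j (col a c)) ab≡i bc≡j (related-sound (<⇒true P≤1 abc)) ,
         subst (λ k → Related (col a c) k (col a d)) cd≡k (related-sound (<⇒true P≤1 acd)) ,
         subst₂ (λ j k → Related j k (col b d)) bc≡j cd≡k (related-sound (<⇒true P≤1 bcd)) ,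
         subst (λ i → Related i (col b d) (col a d)) ab≡i (related-sound (<⇒true P≤1 abd))
      where
      <-drop : ∀ {P x} → 0ℤ ≤ᶻ x → 0ℤ <ᶻ P - x → 0ℤ <ᶻ P
      <-drop {P} {x} 0≤x pos = <-≤-trans pos (≤-by-difference 0≤x (cancel P x))
        where
        cancel : ∀ P x → P - (P - x) ≡ x
        cancel = solve-∀
      <-split : ∀ {P x y} → 0ℤ ≤ᶻ x → 0ℤ ≤ᶻ y → 0ℤ <ᶻ P - (x ⊕ y) → 0ℤ <ᶻ P - x × 0ℤ <ᶻ P - y
      <-split {P} {x} {y} 0≤x 0≤y pos =
        <-drop 0≤y (<-≤-trans pos (≤-reflexive (left P x y))) , <-drop 0≤x (<-≤-trans pos (≤-reflexive (right P x y)))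
        where
        left : ∀ P x y → P - (x ⊕ y) ≡ (P - x) - y
        left = solve-∀
        right : ∀ P x y → P - (x ⊕ y) ≡ (P - y) - x
        right = solve-∀
      path≤1 : ∀ p q r → ⟦ p ⟧ ⊗ (⟦ q ⟧ ⊗ ⟦ r ⟧) ≤ᶻ 1ℤ
      path≤1 p q r = *-mono (0≤⟦⟧ p) (0≤-* (0≤⟦⟧ q) (0≤⟦⟧ r)) (⟦⟧≤1 p) (*-mono (0≤⟦⟧ q) (0≤⟦⟧ r) (⟦⟧≤1 q) (⟦⟧≤1 r))
      <⇒true : ∀ {P b} → P ≤ᶻ 1ℤ → 0ℤ <ᶻ P - ⟦ not b ⟧ → b ≡ true
      <⇒true {b = true}  _   _   = refl
      <⇒true {P} {false} P≤1 pos = ⊥-elim (<-irrefl refl (<-≤-trans pos (+-mono-≤ P≤1 (≤-refl { -1ℤ}))))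
      colours : ∀ x y z → 0ℤ <ᶻ ⟦ x == i ⟧ ⊗ (⟦ y == j ⟧ ⊗ ⟦ z == k ⟧) → x ≡ i × y ≡ j × z ≡ k
      colours x y z pos with x ≟ i | y ≟ j | z ≟ k
      ... | yes x≡i | yes y≡j | yes z≡k = x≡i , y≡j , z≡k
      colours x y z (+<+ ()) | yes _ | yes _ | no _
      colours x y z (+<+ ()) | yes _ | no _  | _
      colours x y z (+<+ ()) | no _  | _     | _

    -- The colour that closes the triangle on the first two edges of a path coloured `i`, `j`, `j`;
    -- by `Related-unique` any other third colour leads to the same value.
    _∙_ : Fin s → Fin s → Fin s
    i ∙ j = proj₁ (associating i j j)

    Related-∙ : ∀ i j → Related i j (i ∙ j)
    Related-∙ i j = proj₁ (proj₂ (proj₂ (proj₂ (associating i j j))))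

    ∙-assoc : ∀ i j k → (i ∙ j) ∙ k ≡ i ∙ (j ∙ k)
    ∙-assoc i j k =
      let x , y , z , ijx , xky , jkz , izy = associating i j k
          x≡ = Related-unique ijx (Related-∙ i j)
          z≡ = Related-unique jkz (Related-∙ j k)
      in trans (Related-unique (Related-∙ (i ∙ j) k) (subst (λ x → Related x k y) x≡ xky))
               (Related-unique (subst (λ z → Related i z y) z≡ izy) (Related-∙ i (j ∙ k)))

    ∙-comm : ∀ i j → i ∙ j ≡ j ∙ i
    ∙-comm i j = Related-unique (Related-swap₁₂ (Related-∙ i j)) (Related-∙ j i)

    -- A triangle coloured `i`, `j`, `i ∙ j` can also be read as one coloured `i`, `i ∙ j`, `j`.
    ∙-involutive : ∀ i j → i ∙ (i ∙ j) ≡ j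
    ∙-involutive i j = Related-unique (Related-∙ i (i ∙ j)) (Related-swap₂₃ (Related-∙ i j))

    colours-power-of-two : Fin s → ∃[ q ] s ≡ 2 ℕ.^ q
    colours-power-of-two i₀ = order-power-of-two i₀ _∙_ ∙-assoc ∙-comm ∙-involutive

-- The graph on the pairs of vertices

_≟ˢ_ : ∀ {n} → DecidableEquality (Subset n)
_≟ˢ_ = ≡-dec Bool._≟_

module _ {n : ℕ} where
  open DecMembership (_≟ˢ_ {n}) public using (_∈?_)

clique-vertices : ∀ {W : Set} (adj : W → W → Bool) → (∀ x y → adj x y ≡ adj y x) → ∀ k S → HasClique adj k S →
  Σ[ f ∈ (Fin k → W) ] ((∀ i → f i ∈ S) × (∀ i j → i ≢ j → adj (f i) (f j) ≡ true))
clique-vertices {W} adj adj-sym ℕ.zero S _ = (λ ()) , (λ ()) , (λ ())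
clique-vertices {W} adj adj-sym (ℕ.suc k) S (x , x∈S , clique) = f , f∈S , f-adj
  where
  IH = clique-vertices adj adj-sym k (filterᵇ (adj x) S) clique
  f : Fin (ℕ.suc k) → W
  f zero    = x
  f (suc i) = proj₁ IH i
  T⇒≡ : ∀ {b} → T b → b ≡ true
  T⇒≡ {true} _ = refl
  in-filter : ∀ i → f (suc i) ∈ S × T (adj x (f (suc i)))
  in-filter i = ∈-filter⁻ (λ y → T? (adj x y)) (proj₁ (proj₂ IH) i)
  f∈S : ∀ i → f i ∈ S
  f∈S zero    = x∈S
  f∈S (suc i) = proj₁ (in-filter i)
  f-adj : ∀ i j → i ≢ j → adj (f i) (f j) ≡ true
  f-adj zero    zero    i≢j = ⊥-elim (i≢j refl)
  f-adj zero    (suc j) _   = T⇒≡ (proj₂ (in-filter j))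
  f-adj (suc i) zero    _   = trans (adj-sym (f (suc i)) x) (T⇒≡ (proj₂ (in-filter i)))
  f-adj (suc i) (suc j) i≢j = proj₂ (proj₂ IH) i j (i≢j ∘ cong suc)

∣p∪q∣+∣p∩q∣ : ∀ {n} (p q : Subset n) → ∣ p ∪ q ∣ ℕ.+ ∣ p ∩ q ∣ ≡ ∣ p ∣ ℕ.+ ∣ q ∣
∣p∪q∣+∣p∩q∣ []            []            = refl
∣p∪q∣+∣p∩q∣ (outside ∷ p) (outside ∷ q) = ∣p∪q∣+∣p∩q∣ p q
∣p∪q∣+∣p∩q∣ (outside ∷ p) (inside  ∷ q) = trans (cong ℕ.suc (∣p∪q∣+∣p∩q∣ p q)) (sym (ℕ.+-suc ∣ p ∣ ∣ q ∣))
∣p∪q∣+∣p∩q∣ (inside  ∷ p) (outside ∷ q) = cong ℕ.suc (∣p∪q∣+∣p∩q∣ p q)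
∣p∪q∣+∣p∩q∣ (inside  ∷ p) (inside  ∷ q) = cong ℕ.suc (trans (ℕ.+-suc ∣ p ∪ q ∣ ∣ p ∩ q ∣) (trans (cong ℕ.suc (∣p∪q∣+∣p∩q∣ p q)) (sym (ℕ.+-suc ∣ p ∣ ∣ q ∣))))

pair : ∀ {n} → Fin n → Fin n → Subset n
pair a b = ⁅ a ⁆ ∪ ⁅ b ⁆

∣pair∣≤2 : ∀ {n} (a b : Fin n) → ∣ pair a b ∣ ℕ.≤ 2
∣pair∣≤2 a b = ℕ.≤-trans (ℕ.m≤m+n ∣ pair a b ∣ ∣ ⁅ a ⁆ ∩ ⁅ b ⁆ ∣)
  (ℕ.≤-reflexive (trans (∣p∪q∣+∣p∩q∣ ⁅ a ⁆ ⁅ b ⁆) (cong₂ ℕ._+_ (∣⁅x⁆∣≡1 a) (∣⁅x⁆∣≡1 b))))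

-- In `4 + ∣ p ∩ q ∣ = ∣ p ∣ + ∣ q ∣ ≤ 4` everything is tight. Thus adjacency alone certifies that
-- the pairs are proper and disjoint.
quadruple-split : ∀ {n} {p q : Subset n} → ∣ p ∣ ℕ.≤ 2 → ∣ q ∣ ℕ.≤ 2 → ∣ p ∪ q ∣ ≡ 4 → ∣ p ∣ ≡ 2 × Empty (p ∩ q)
quadruple-split {p = p} {q} p≤2 q≤2 p∪q≡4 = ℕ.≤-antisym p≤2 2≤p , empty
  where
  sum≡ : 4 ℕ.+ ∣ p ∩ q ∣ ≡ ∣ p ∣ ℕ.+ ∣ q ∣
  sum≡ = trans (cong (ℕ._+ ∣ p ∩ q ∣) (sym p∪q≡4)) (∣p∪q∣+∣p∩q∣ p q)
  2≤p : 2 ℕ.≤ ∣ p ∣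
  2≤p = ℕ.+-cancelʳ-≤ 2 2 ∣ p ∣ (ℕ.≤-trans (ℕ.m≤m+n 4 ∣ p ∩ q ∣) (ℕ.≤-trans (ℕ.≤-reflexive sum≡) (ℕ.+-monoʳ-≤ ∣ p ∣ q≤2)))
  ∩≤0 : ∣ p ∩ q ∣ ℕ.≤ 0
  ∩≤0 = ℕ.+-cancelˡ-≤ 4 ∣ p ∩ q ∣ 0 (ℕ.≤-trans (ℕ.≤-reflexive sum≡) (ℕ.+-mono-≤ p≤2 q≤2))
  empty : Empty (p ∩ q)
  empty (x , x∈) = ℕ.1+n≰n (ℕ.≤-trans (s≤s z≤n) (ℕ.≤-trans (x∈p⇒∣p-x∣<∣p∣ x∈) ∩≤0))

-- Edges counted through ordered quadruples

lookup-∖ : ∀ {n} (p : Subset n) a → Vec.lookup p a ≡ true → ∣ p ∣ ≡ ℕ.suc ∣ p ∖ a ∣ × ⁅ a ⁆ ∪ (p ∖ a) ≡ p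
lookup-∖ (inside ∷ p) zero refl = cong (ℕ.suc ∘ ∣_∣) (sym (p─⊥≡p p)) , cong (inside ∷_) (trans (∪-identityˡ _) (p─⊥≡p p))
lookup-∖ (outside ∷ p) (suc a) eq with lookup-∖ p a eq
... | size , restore = size , cong (outside ∷_) restore
lookup-∖ (inside ∷ p) (suc a) eq with lookup-∖ p a eq
... | size , restore = cong ℕ.suc size , cong (inside ∷_) restore

∑-lookup : ∀ {n} (p : Subset n) → ∑[ a ∈ allFin n ] ⟦ Vec.lookup p a ⟧ ≡ + ∣ p ∣
∑-lookup []            = refl
∑-lookup {ℕ.suc n} (inside  ∷ p) = trans (∑-allFin-suc n (λ a → ⟦ Vec.lookup (inside ∷ p) a ⟧)) (cong (1ℤ ⊕_) (∑-lookup p))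
∑-lookup {ℕ.suc n} (outside ∷ p) = trans (∑-allFin-suc n (λ a → ⟦ Vec.lookup (outside ∷ p) a ⟧)) (cong (0ℤ ⊕_) (∑-lookup p))

⟦≟⟧ : ∀ {n} → Subset n → Subset n → ℤ
⟦≟⟧ p q = ⟦ does (p ≟ˢ q) ⟧

-- The sum runs over all ordered `k`-tuples, repetitions included, and `g` sees only the underlying
-- set. For `k = 4` it unfolds to the fourfold sum over the vertices.
∑-sets : ∀ {n} → ℕ → (Subset n → ℤ) → ℤ
∑-sets     ℕ.zero    g = g ⊥
∑-sets {n} (ℕ.suc k) g = ∑[ a ∈ allFin n ] ∑-sets k (λ q → g (⁅ a ⁆ ∪ q))

∑-sets-mono : ∀ {n} k {g h : Subset n → ℤ} → (∀ q → g q ≤ᶻ h q) → ∑-sets k g ≤ᶻ ∑-sets k h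
∑-sets-mono ℕ.zero    g≤h = g≤h ⊥
∑-sets-mono (ℕ.suc k) g≤h = ∑-mono (allFin _) λ a → ∑-sets-mono k (λ q → g≤h (⁅ a ⁆ ∪ q))

∑-sets-nonneg : ∀ {n} k {g : Subset n → ℤ} → (∀ q → 0ℤ ≤ᶻ g q) → 0ℤ ≤ᶻ ∑-sets k g
∑-sets-nonneg ℕ.zero    0≤g = 0≤g ⊥
∑-sets-nonneg (ℕ.suc k) 0≤g = ∑-nonneg (allFin _) λ a → ∑-sets-nonneg k (λ q → 0≤g (⁅ a ⁆ ∪ q))

∣p∣≡0⇒p≡⊥ : ∀ {n} (p : Subset n) → ∣ p ∣ ≡ 0 → p ≡ ⊥
∣p∣≡0⇒p≡⊥ []            _  = refl
∣p∣≡0⇒p≡⊥ (outside ∷ p) eq = cong (outside ∷_) (∣p∣≡0⇒p≡⊥ p eq)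

-- An ordering of `p` is a first element `a` of `p` followed by an ordering of `p ∖ a`.
orderings : ∀ {n} k (p : Subset n) → ∣ p ∣ ≡ k → + (k !) ≤ᶻ ∑-sets k (λ q → ⟦≟⟧ q p)
orderings ℕ.zero p eq with ⊥ ≟ˢ p
... | yes _   = ≤-refl
... | no  ⊥≢p = contradiction (sym (∣p∣≡0⇒p≡⊥ p eq)) ⊥≢p
orderings {n} (ℕ.suc k) p eq = begin
  + (ℕ.suc k ℕ.* k !)
    ≡⟨ pos-* (ℕ.suc k) (k !) ⟩
  + ℕ.suc k ⊗ + (k !)
    ≡⟨ cong (_⊗ + (k !)) (trans (cong +_ (sym eq)) (sym (∑-lookup p))) ⟩
  (∑[ a ∈ allFin n ] ⟦ Vec.lookup p a ⟧) ⊗ + (k !)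
    ≡⟨ sym (∑-*ʳ (allFin n) (+ (k !)) (λ a → ⟦ Vec.lookup p a ⟧)) ⟩
  ∑[ a ∈ allFin n ] (⟦ Vec.lookup p a ⟧ ⊗ + (k !))
    ≤⟨ ∑-mono (allFin n) first ⟩
  ∑[ a ∈ allFin n ] ∑-sets k (λ q → ⟦≟⟧ (⁅ a ⁆ ∪ q) p) ∎
  where
  open ≤-Reasoning
  insert : ∀ a → ⁅ a ⁆ ∪ (p ∖ a) ≡ p → ∀ q → ⟦≟⟧ q (p ∖ a) ≤ᶻ ⟦≟⟧ (⁅ a ⁆ ∪ q) p
  insert a restore q with q ≟ˢ (p ∖ a) | (⁅ a ⁆ ∪ q) ≟ˢ p
  ... | no _     | c     = 0≤⟦⟧ (does c)
  ... | yes _    | yes _ = ≤-refl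
  ... | yes refl | no ≢p = contradiction restore ≢p
  first : ∀ a → ⟦ Vec.lookup p a ⟧ ⊗ + (k !) ≤ᶻ ∑-sets k (λ q → ⟦≟⟧ (⁅ a ⁆ ∪ q) p)
  first a with Vec.lookup p a in a∈p
  ... | false = ∑-sets-nonneg k (λ q → 0≤⟦⟧ (does ((⁅ a ⁆ ∪ q) ≟ˢ p)))
  ... | true  with lookup-∖ p a a∈p
  ...   | size , restore = ≤-trans (≤-reflexive (*-identityˡ (+ (k !))))
    (≤-trans (orderings k (p ∖ a) (ℕ.suc-injective (trans (sym size) eq))) (∑-sets-mono k (insert a restore)))

∑-≟≤∈ : ∀ {n} {L : List (Subset n)} → Unique L → ∀ q → ∑[ p ∈ L ] ⟦≟⟧ q p ≤ᶻ ⟦ does (q ∈? L) ⟧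
∑-≟≤∈ [] q = ≤-refl
∑-≟≤∈ {L = p ∷ L} (p∉L ∷ L!) q with q ≟ˢ p
... | no  _    = ≤-trans (≤-reflexive (0ℤ⊕ _)) (∑-≟≤∈ L! q)
  where
  0ℤ⊕ : ∀ x → 0ℤ ⊕ x ≡ x
  0ℤ⊕ = solve-∀
... | yes refl = +-mono-≤ (≤-refl {1ℤ}) (≤-trans (∑-mono-∈ L none) (≤-reflexive (∑-zero L)))
  where
  none : ∀ {p} → p ∈ L → ⟦≟⟧ q p ≤ᶻ 0ℤ
  none {p} p∈ with q ≟ˢ p
  ... | yes q≡p = contradiction q≡p (All.lookup p∉L p∈)
  ... | no  _   = ≤-refl

∑-sets-∑ : ∀ {n} {B : Set} k (ys : List B) (g : B → Subset n → ℤ) →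
  ∑-sets k (λ q → ∑[ y ∈ ys ] g y q) ≡ ∑[ y ∈ ys ] ∑-sets k (g y)
∑-sets-∑ ℕ.zero    ys g = refl
∑-sets-∑ (ℕ.suc k) ys g = trans (∑-cong (allFin _) λ a → ∑-sets-∑ k ys (λ y q → g y (⁅ a ⁆ ∪ q)))
  (∑-swap (allFin _) ys (λ a y → ∑-sets k (λ q → g y (⁅ a ⁆ ∪ q))))

module _ {n : ℕ} (H : UniformHypergraph 4 n) where

  -- All `n²` ordered pairs are vertices, so that a sum over two pairs is a plain fourfold sum;
  -- pairs with equal entries are isolated.
  pair-adj : Fin n × Fin n → Fin n × Fin n → Bool
  pair-adj (a , b) (c , d) = does ((pair a b ∪ pair c d) ∈? edges H)

  pair-adj-sym : ∀ x y → pair-adj x y ≡ pair-adj y x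
  pair-adj-sym (a , b) (c , d) = cong (λ q → does (q ∈? edges H)) (∪-comm (pair a b) (pair c d))

  pair-adj-twins : ∀ a b z → pair-adj z (a , b) ≡ pair-adj z (b , a)
  pair-adj-twins a b (c , d) = cong (λ q → does ((pair c d ∪ q) ∈? edges H)) (∪-comm ⁅ a ⁆ ⁅ b ⁆)

  pair-adj-swap : ∀ a b c d → pair-adj (a , b) (c , d) ≡ pair-adj (a , c) (b , d)
  pair-adj-swap a b c d = cong (λ q → does (q ∈? edges H)) (begin
    (⁅ a ⁆ ∪ ⁅ b ⁆) ∪ (⁅ c ⁆ ∪ ⁅ d ⁆)   ≡⟨ ∪-assoc ⁅ a ⁆ ⁅ b ⁆ (⁅ c ⁆ ∪ ⁅ d ⁆) ⟩
    ⁅ a ⁆ ∪ (⁅ b ⁆ ∪ (⁅ c ⁆ ∪ ⁅ d ⁆))   ≡⟨ cong (⁅ a ⁆ ∪_) (sym (∪-assoc ⁅ b ⁆ ⁅ c ⁆ ⁅ d ⁆)) ⟩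
    ⁅ a ⁆ ∪ ((⁅ b ⁆ ∪ ⁅ c ⁆) ∪ ⁅ d ⁆)   ≡⟨ cong (λ q → ⁅ a ⁆ ∪ (q ∪ ⁅ d ⁆)) (∪-comm ⁅ b ⁆ ⁅ c ⁆) ⟩
    ⁅ a ⁆ ∪ ((⁅ c ⁆ ∪ ⁅ b ⁆) ∪ ⁅ d ⁆)   ≡⟨ cong (⁅ a ⁆ ∪_) (∪-assoc ⁅ c ⁆ ⁅ b ⁆ ⁅ d ⁆) ⟩
    ⁅ a ⁆ ∪ (⁅ c ⁆ ∪ (⁅ b ⁆ ∪ ⁅ d ⁆))   ≡⟨ sym (∪-assoc ⁅ a ⁆ ⁅ c ⁆ (⁅ b ⁆ ∪ ⁅ d ⁆)) ⟩
    (⁅ a ⁆ ∪ ⁅ c ⁆) ∪ (⁅ b ⁆ ∪ ⁅ d ⁆)   ∎)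
    where open ≡-Reasoning

  clique⇒copy : ∀ k S → HasClique pair-adj (2 ℕ.+ k) S → CopyOfC⁽⁴⁾ (2 ℕ.+ k) H
  clique⇒copy k S clique = record
    { P        = P
    ; size     = λ i → proj₁ (proper i (other i) (other-≢ i))
    ; disjoint = λ i j i≢j → proj₂ (proper i j i≢j)
    ; present  = present
    }
    where
    found = clique-vertices pair-adj pair-adj-sym (2 ℕ.+ k) S clique
    f = proj₁ found
    P : Fin (2 ℕ.+ k) → Subset n
    P i = pair (proj₁ (f i)) (proj₂ (f i))
    present : ∀ i j → i ≢ j → P i ∪ P j ∈ edges H
    present i j i≢j with (P i ∪ P j) ∈? edges H | proj₂ (proj₂ found) i j i≢j
    ... | yes present | _ = present
    ... | no _        | ()
    proper : ∀ i j → i ≢ j → ∣ P i ∣ ≡ 2 × Empty (P i ∩ P j)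
    proper i j i≢j = quadruple-split (∣pair∣≤2 (proj₁ (f i)) (proj₂ (f i))) (∣pair∣≤2 (proj₁ (f j)) (proj₂ (f j))) (All.lookup (uniform H) (present i j i≢j))
    -- The size of `P i` is read off an edge that contains it, so some second index is required;
    -- there is one as the clique has at least two vertices.
    other : Fin (2 ℕ.+ k) → Fin (2 ℕ.+ k)
    other zero    = suc zero
    other (suc _) = zero
    other-≢ : ∀ i → i ≢ other i
    other-≢ zero    ()
    other-≢ (suc i) ()

  V = allFin n

  pair-adj-count : + 24 ⊗ + edgeCount H ≤ᶻ ∑[ a ∈ V ] ∑[ b ∈ V ] ∑[ c ∈ V ] ∑[ d ∈ V ] ⟦ pair-adj (a , b) (c , d) ⟧
  pair-adj-count = begin
    + 24 ⊗ + edgeCount H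
      ≡⟨ *-comm (+ 24) (+ edgeCount H) ⟩
    + edgeCount H ⊗ + 24
      ≡⟨ sym (∑-const (edges H) (+ 24)) ⟩
    ∑[ p ∈ edges H ] + 24
      ≤⟨ ∑-mono-∈ (edges H) (λ {p} p∈ → orderings 4 p (All.lookup (uniform H) p∈)) ⟩
    ∑[ p ∈ edges H ] ∑-sets 4 (λ q → ⟦≟⟧ q p)
      ≡⟨ sym (∑-sets-∑ 4 (edges H) (λ p q → ⟦≟⟧ q p)) ⟩
    ∑-sets 4 (λ q → ∑[ p ∈ edges H ] ⟦≟⟧ q p)
      ≤⟨ ∑-sets-mono 4 {g = λ q → ∑[ p ∈ edges H ] ⟦≟⟧ q p} {h = λ q → ⟦ does (q ∈? edges H) ⟧} (∑-≟≤∈ (unique H)) ⟩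
    ∑-sets 4 (λ q → ⟦ does (q ∈? edges H) ⟧)
      ≡⟨ (∑-cong V λ a → ∑-cong V λ b → ∑-cong V λ c → ∑-cong V λ d → cong (λ q → ⟦ does (q ∈? edges H) ⟧)
           (trans (cong (λ q → ⁅ a ⁆ ∪ (⁅ b ⁆ ∪ (⁅ c ⁆ ∪ q))) (∪-identityʳ ⁅ d ⁆)) (sym (∪-assoc ⁅ a ⁆ ⁅ b ⁆ (⁅ c ⁆ ∪ ⁅ d ⁆))))) ⟩
    ∑[ a ∈ V ] ∑[ b ∈ V ] ∑[ c ∈ V ] ∑[ d ∈ V ] ⟦ pair-adj (a , b) (c , d) ⟧ ∎
    where open ≤-Reasoning

-- Arithmetic of the density bound

density-in-integers : ∀ a b E c e .{{_ : NonZero b}} .{{_ : NonZero E}} →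
  ((+ a / b) ℚ.- (+ 1 / E)) * (+ c / 1) ≤ℚ + e / 1 →
  + a ⊗ + E ⊗ + c ≤ᶻ + b ⊗ + E ⊗ + e ⊕ + b ⊗ + c
density-in-integers a b@(ℕ.suc _) E@(ℕ.suc _) c e h = ≤-by-difference (i≤j⇒0≤j-i (drop-*≤* h)) (trans
  (clear (+ a) (+ b) (+ E) (+ c) (+ e))
  (cong (λ d → + e ⊗ d - ((+ a ⊗ + E ⊕ ⊖ 1ℤ ⊗ + b) ⊗ + c) ⊗ 1ℤ) (sym (trans (cong +_ (ℕ.*-identityʳ (b ℕ.* E))) (pos-* b E)))))
  where
  clear : ∀ a b E c e → (b ⊗ E ⊗ e ⊕ b ⊗ c) - a ⊗ E ⊗ c ≡ e ⊗ (b ⊗ E) - ((a ⊗ E ⊕ ⊖ 1ℤ ⊗ b) ⊗ c) ⊗ 1ℤ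
  clear = solve-∀

pascal : ∀ n k → + (ℕ.suc n C ℕ.suc k) ≡ + (n C k) ⊕ + (n C ℕ.suc k)
pascal n k = cong +_ (sym (nCk+nC[k+1]≡[n+1]C[k+1] n k))

-- These product formulas live in the integers to avoid truncated subtraction; for small `n` a
-- factor vanishes.
2*nC2 : ∀ n → + 2 ⊗ + (n C 2) ≡ + n ⊗ (+ n - 1ℤ)
2*nC2 ℕ.zero    = refl
2*nC2 (ℕ.suc n) = trans (cong (+ 2 ⊗_) (trans (pascal n 1) (cong (λ x → + x ⊕ + (n C 2)) (nC1≡n n))))
  (trans (step₁ (+ n) (+ (n C 2))) (trans (cong (+ 2 ⊗ + n ⊕_) (2*nC2 n)) (step₂ (+ n))))
  where
  step₁ : ∀ n x → + 2 ⊗ (n ⊕ x) ≡ + 2 ⊗ n ⊕ + 2 ⊗ x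
  step₁ = solve-∀
  step₂ : ∀ n → + 2 ⊗ n ⊕ n ⊗ (n - 1ℤ) ≡ (1ℤ ⊕ n) ⊗ ((1ℤ ⊕ n) - 1ℤ)
  step₂ = solve-∀

6*nC3 : ∀ n → + 6 ⊗ + (n C 3) ≡ + n ⊗ (+ n - 1ℤ) ⊗ (+ n - + 2)
6*nC3 ℕ.zero    = refl
6*nC3 (ℕ.suc n) = trans (cong (+ 6 ⊗_) (pascal n 2)) (trans (step₁ (+ (n C 2)) (+ (n C 3)))
  (trans (cong₂ (λ x y → + 3 ⊗ x ⊕ y) (2*nC2 n) (6*nC3 n)) (step₂ (+ n))))
  where
  step₁ : ∀ x y → + 6 ⊗ (x ⊕ y) ≡ + 3 ⊗ (+ 2 ⊗ x) ⊕ + 6 ⊗ y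
  step₁ = solve-∀
  step₂ : ∀ n → + 3 ⊗ (n ⊗ (n - 1ℤ)) ⊕ n ⊗ (n - 1ℤ) ⊗ (n - + 2) ≡ (1ℤ ⊕ n) ⊗ ((1ℤ ⊕ n) - 1ℤ) ⊗ ((1ℤ ⊕ n) - + 2)
  step₂ = solve-∀

24*nC4 : ∀ n → + 24 ⊗ + (n C 4) ≡ + n ⊗ (+ n - 1ℤ) ⊗ (+ n - + 2) ⊗ (+ n - + 3)
24*nC4 ℕ.zero    = refl
24*nC4 (ℕ.suc n) = trans (cong (+ 24 ⊗_) (pascal n 3)) (trans (step₁ (+ (n C 3)) (+ (n C 4)))
  (trans (cong₂ (λ x y → + 4 ⊗ x ⊕ y) (6*nC3 n) (24*nC4 n)) (step₂ (+ n))))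
  where
  step₁ : ∀ x y → + 24 ⊗ (x ⊕ y) ≡ + 4 ⊗ (+ 6 ⊗ x) ⊕ + 24 ⊗ y
  step₁ = solve-∀
  step₂ : ∀ n → + 4 ⊗ (n ⊗ (n - 1ℤ) ⊗ (n - + 2)) ⊕ n ⊗ (n - 1ℤ) ⊗ (n - + 2) ⊗ (n - + 3) ≡
    (1ℤ ⊕ n) ⊗ ((1ℤ ⊕ n) - 1ℤ) ⊗ ((1ℤ ⊕ n) - + 2) ⊗ ((1ℤ ⊕ n) - + 3)
  step₂ = solve-∀

falling-≤ : ∀ {n c} → 0ℤ ≤ᶻ n → c ≡ n ⊗ (n - 1ℤ) ⊗ (n - + 2) ⊗ (n - + 3) → c ≤ᶻ n ⊗ (n ⊗ (n ⊗ n))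
falling-≤ {n} 0≤n refl = ≤-by-difference (0≤-* 0≤n (0≤-+ (0≤-* {+ 6} 0≤+ (0≤x² (n - 1ℤ))) 0≤n)) (identity n)
  where
  identity : ∀ n → n ⊗ (n ⊗ (n ⊗ n)) - n ⊗ (n - 1ℤ) ⊗ (n - + 2) ⊗ (n - + 3) ≡ n ⊗ (+ 6 ⊗ ((n - 1ℤ) ⊗ (n - 1ℤ)) ⊕ n)
  identity = solve-∀

falling-≥ : ∀ {n c} → 1ℤ ≤ᶻ n → c ≡ n ⊗ (n - 1ℤ) ⊗ (n - + 2) ⊗ (n - + 3) → n ⊗ (n ⊗ (n ⊗ n)) ≤ᶻ c ⊕ + 6 ⊗ (n ⊗ (n ⊗ n))
falling-≥ {n} 1≤n refl = ≤-by-difference (0≤-* 0≤n (0≤-+ (0≤-* {+ 5} 0≤+ 0≤n) (0≤-* {+ 6} 0≤+ (i≤j⇒0≤j-i 1≤n)))) (identity n)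
  where
  0≤n = ≤-trans {0ℤ} {1ℤ} 0≤+ 1≤n
  identity : ∀ n → (n ⊗ (n - 1ℤ) ⊗ (n - + 2) ⊗ (n - + 3) ⊕ + 6 ⊗ (n ⊗ (n ⊗ n))) - n ⊗ (n ⊗ (n ⊗ n)) ≡ n ⊗ (+ 5 ⊗ n ⊕ + 6 ⊗ (n - 1ℤ))
  identity = solve-∀

-- One loss `1/E` comes from the hypothesis on the edges. The other comes from passing to `N⁴` from
-- the falling factorial, a gap of at most `6N³`, which is at most `N⁴/E` since `6E ≤ N`.
dense-tuples : ∀ {S E N c e D} → 1ℤ ≤ᶻ S → 0ℤ ≤ᶻ E → 1ℤ ≤ᶻ N → + 6 ⊗ E ≤ᶻ N →
  + 24 ⊗ c ≡ N ⊗ (N - 1ℤ) ⊗ (N - + 2) ⊗ (N - + 3) → + 24 ⊗ e ≤ᶻ D →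
  (S - 1ℤ) ⊗ E ⊗ c ≤ᶻ S ⊗ E ⊗ e ⊕ S ⊗ c →
  (S - 1ℤ) ⊗ E ⊗ (N ⊗ (N ⊗ (N ⊗ N))) ≤ᶻ S ⊗ E ⊗ D ⊕ + 2 ⊗ S ⊗ (N ⊗ (N ⊗ (N ⊗ N)))
dense-tuples {S} {E} {N} {c} {e} {D} 1≤S 0≤E 1≤N 6E≤N c≡ e≤D h = ≤-by-difference
  (0≤-+ (0≤-* (0≤-* 0≤S 0≤E) (i≤j⇒0≤j-i e≤D))
  (0≤-+ (0≤-* {+ 24} 0≤+ (i≤j⇒0≤j-i h))
  (0≤-+ (0≤-* (0≤-* 0≤S-1 0≤E) (i≤j⇒0≤j-i (falling-≥ 1≤N c≡)))
  (0≤-+ (0≤-* (0≤-* 0≤S-1 0≤N³) (i≤j⇒0≤j-i 6E≤N))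
  (0≤-+ (0≤-* 0≤S (i≤j⇒0≤j-i (falling-≤ 0≤N c≡)))
        (0≤-* 0≤N 0≤N³))))))
  (identity S E (N ⊗ (N ⊗ N)) N c e D)
  where
  0≤S = ≤-trans {0ℤ} {1ℤ} 0≤+ 1≤S
  0≤S-1 = i≤j⇒0≤j-i 1≤S
  0≤N = ≤-trans {0ℤ} {1ℤ} 0≤+ 1≤N
  0≤N³ = 0≤-* 0≤N (0≤-* 0≤N 0≤N)
  identity : ∀ s E n³ n c e d →
    (s ⊗ E ⊗ d ⊕ + 2 ⊗ s ⊗ (n ⊗ n³)) - (s - 1ℤ) ⊗ E ⊗ (n ⊗ n³) ≡
    s ⊗ E ⊗ (d - + 24 ⊗ e) ⊕ (+ 24 ⊗ ((s ⊗ E ⊗ e ⊕ s ⊗ c) - (s - 1ℤ) ⊗ E ⊗ c) ⊕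
    ((s - 1ℤ) ⊗ E ⊗ ((+ 24 ⊗ c ⊕ + 6 ⊗ n³) - (n ⊗ n³)) ⊕ ((s - 1ℤ) ⊗ n³ ⊗ (n - + 6 ⊗ E) ⊕
    (s ⊗ ((n ⊗ n³) - + 24 ⊗ c) ⊕ (n ⊗ n³)))))
  identity = solve-∀

-- From the hypergraph to the number of colours

colour-count-power-of-two : ∀ {n k} (H : UniformHypergraph 4 n) → ¬ CopyOfC⁽⁴⁾ (2 ℕ.+ k) H →
  ∀ (N S E L : ℤ) → N ≡ + n → S ≡ + ℕ.suc k → L ≡ + 147456 → 1ℤ ≤ᶻ N →
  L ⊗ ((S ⊗ S ⊗ S ⊗ S ⊗ S ⊗ S) ⊗ (S ⊗ S ⊗ S ⊗ S ⊗ S ⊗ S)) <ᶻ E → + 6 ⊗ E ≤ᶻ N →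
  (S - 1ℤ) ⊗ E ⊗ + (n C 4) ≤ᶻ S ⊗ E ⊗ + edgeCount H ⊕ S ⊗ + (n C 4) →
  ∃[ q ] ℕ.suc k ≡ 2 ℕ.^ q
colour-count-power-of-two {n} {k} H noCopy N S E L N≡n S≡ L≡ 1≤N E-large 6E≤N dense-edges
  with clique-free⇒colouring (pair-adj H) (pair-adj-sym H) k (cartesianProduct (allFin n) (allFin n))
         (λ clique → noCopy (clique⇒copy H k (cartesianProduct (allFin n) (allFin n)) clique))
... | colour , respects , bound = colours-power-of-two zero
  where
  Vₙ = allFin n

  col : Fin n → Fin n → Fin (ℕ.suc k)
  col a b = colour (a , b)

  col-sym : ∀ a b → col a b ≡ col b a
  col-sym a b = respects (a , b) (b , a) (pair-adj-twins H a b)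

  N≡ : N ≡ + length Vₙ
  N≡ = trans N≡n (cong +_ (sym (length-tabulate {n = n} id)))

  open Counting Vₙ N N≡ S S≡ col col-sym using (∑⁴; module Stability; module Associativity)

  1≤S : 1ℤ ≤ᶻ S
  1≤S = subst (1ℤ ≤ᶻ_) (sym S≡) (+≤+ (s≤s z≤n))

  0≤L : 0ℤ ≤ᶻ L
  0≤L = subst (0ℤ ≤ᶻ_) (sym L≡) 0≤+

  0≤E : 0ℤ ≤ᶻ E
  0≤E = ≤-trans (0≤-* 0≤L (0≤x² (S ⊗ S ⊗ S ⊗ S ⊗ S ⊗ S))) (<⇒≤ E-large)

  0<1 : 0ℤ <ᶻ 1ℤ
  0<1 = +<+ (s≤s z≤n)

  adj : Fin n → Fin n → Fin n → Fin n → Bool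
  adj a b c d = pair-adj H (a , b) (c , d)

  ∑-pairs : ∀ (F : Fin n × Fin n → Fin n × Fin n → ℤ) →
    ∑[ x ∈ cartesianProduct Vₙ Vₙ ] ∑[ y ∈ cartesianProduct Vₙ Vₙ ] F x y ≡ ∑⁴ λ a b c d → F (a , b) (c , d)
  ∑-pairs F = trans (∑-cartesianProduct Vₙ Vₙ (λ x → ∑[ y ∈ cartesianProduct Vₙ Vₙ ] F x y))
    (∑-cong Vₙ λ a → ∑-cong Vₙ λ b → ∑-cartesianProduct Vₙ Vₙ (F (a , b)))

  furedi : ∑⁴ (λ a b c d → ⟦ adj a b c d ⟧ ⊕ ⟦ adj a b c d ∧ (col a b == col c d) ⟧) ≤ᶻ ∑⁴ (λ a b c d → ⟦ not (col a b == col c d) ⟧)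
  furedi = ≤-trans (≤-reflexive (sym (∑-pairs (λ x y → ⟦ pair-adj H x y ⟧ ⊕ monochromatic-adjacent (pair-adj H) colour x y))))
    (≤-trans bound (≤-reflexive (∑-pairs (bichromatic (pair-adj H) colour))))

  dense : (S - 1ℤ) ⊗ E ⊗ (N ⊗ (N ⊗ (N ⊗ N))) ≤ᶻ S ⊗ E ⊗ ∑⁴ (λ a b c d → ⟦ adj a b c d ⟧) ⊕ + 2 ⊗ S ⊗ (N ⊗ (N ⊗ (N ⊗ N)))
  dense = dense-tuples 1≤S 0≤E 1≤N 6E≤N
    (subst (λ N → + 24 ⊗ + (n C 4) ≡ N ⊗ (N - 1ℤ) ⊗ (N - + 2) ⊗ (N - + 3)) (sym N≡n) (24*nC4 n))
    (pair-adj-count H) dense-edges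

  open Stability adj (pair-adj-swap H) (<-≤-trans 0<1 1≤S) E 0≤E furedi dense using (few-bad; balanced)
  open Associativity (<-≤-trans 0<1 1≤N) 1≤S E L L≡ E-large few-bad balanced using (colours-power-of-two)

pos-^ : ∀ m k → + (m ℕ.^ k) ≡ (+ m) ^ℤ k
pos-^ m ℕ.zero    = refl
pos-^ m (ℕ.suc k) = trans (pos-* m (m ℕ.^ k)) (cong (+ m ⊗_) (pos-^ m k))

sixth-power : ∀ {S} m → S ≡ + m → S ⊗ S ⊗ S ⊗ S ⊗ S ⊗ S ≡ + (m ℕ.^ 6)
sixth-power m refl = trans (right-nested (+ m)) (sym (pos-^ m 6))
  where
  right-nested : ∀ x → x ⊗ x ⊗ x ⊗ x ⊗ x ⊗ x ≡ x ⊗ (x ⊗ (x ⊗ (x ⊗ (x ⊗ (x ⊗ 1ℤ)))))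
  right-nested = solve-∀

power-gap : ∀ {c d m r a b} .{{_ : NonZero r}} → m ℕ.≤ r → a ℕ.+ a ℕ.≤ b → c ℕ.< d → c ℕ.* (m ℕ.^ a ℕ.* m ℕ.^ a) ℕ.< r ℕ.^ b ℕ.* d
power-gap {c} {d} {m} {r} {a} {b} m≤r 2a≤b c<d = begin-strict
  c ℕ.* (m ℕ.^ a ℕ.* m ℕ.^ a)   ≡⟨ cong (c ℕ.*_) (sym (ℕ.^-distribˡ-+-* m a a)) ⟩
  c ℕ.* m ℕ.^ (a ℕ.+ a)         ≤⟨ ℕ.*-monoʳ-≤ c (ℕ.^-monoˡ-≤ (a ℕ.+ a) m≤r) ⟩
  c ℕ.* r ℕ.^ (a ℕ.+ a)         ≤⟨ ℕ.*-monoʳ-≤ c (ℕ.^-monoʳ-≤ r 2a≤b) ⟩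
  c ℕ.* r ℕ.^ b                 <⟨ ℕ.*-monoˡ-< (r ℕ.^ b) {{ℕ.m^n≢0 r b}} c<d ⟩
  d ℕ.* r ℕ.^ b                 ≡⟨ ℕ.*-comm d (r ℕ.^ b) ⟩
  r ℕ.^ b ℕ.* d                 ∎
  where open ℕ.≤-Reasoning

power-of-two-plus-one : ∀ {n c} r E → 3 ℕ.≤ r → c ≡ 147456 → c ℕ.* ((r ∸ 1) ℕ.^ 6 ℕ.* (r ∸ 1) ℕ.^ 6) ℕ.< E → 6 ℕ.* E ℕ.≤ n →
  (H : UniformHypergraph 4 n) →
  + (r ∸ 2) ⊗ + E ⊗ + (n C 4) ≤ᶻ + (r ∸ 1) ⊗ + E ⊗ + edgeCount H ⊕ + (r ∸ 1) ⊗ + (n C 4) →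
  ¬ CopyOfC⁽⁴⁾ r H → ∃[ p ] (1 ℕ.≤ p × r ≡ 2 ℕ.^ p ℕ.+ 1)
power-of-two-plus-one (ℕ.suc ℕ.zero) E (s≤s ())
power-of-two-plus-one {n} {c} r@(ℕ.suc (ℕ.suc k)) E 3≤r c≡ E-large 6E≤n H dense noCopy =
  exponent (colour-count-power-of-two H noCopy (+ n) S (+ E) (+ c) refl refl (cong +_ c≡)
    (+≤+ (ℕ.≤-trans 0<E (ℕ.≤-trans (ℕ.m≤n*m E 6) 6E≤n)))
    large
    (≤-trans (≤-reflexive (sym (pos-* 6 E))) (+≤+ 6E≤n))
    dense)
  where
  0<E : 0 ℕ.< E
  0<E = ℕ.≤-trans (s≤s z≤n) E-large
  m⁶ = ℕ.suc k ℕ.^ 6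
  S = + ℕ.suc k
  large : + c ⊗ ((S ⊗ S ⊗ S ⊗ S ⊗ S ⊗ S) ⊗ (S ⊗ S ⊗ S ⊗ S ⊗ S ⊗ S)) <ᶻ + E
  large = begin-strict
    + c ⊗ ((S ⊗ S ⊗ S ⊗ S ⊗ S ⊗ S) ⊗ (S ⊗ S ⊗ S ⊗ S ⊗ S ⊗ S))
                               ≡⟨ cong (λ x → + c ⊗ (x ⊗ x)) (sixth-power (ℕ.suc k) refl) ⟩
    + c ⊗ (+ m⁶ ⊗ + m⁶)        ≡⟨ cong (+ c ⊗_) (sym (pos-* m⁶ m⁶)) ⟩
    + c ⊗ + (m⁶ ℕ.* m⁶)        ≡⟨ sym (pos-* c (m⁶ ℕ.* m⁶)) ⟩
    + (c ℕ.* (m⁶ ℕ.* m⁶))      <⟨ +<+ E-large ⟩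
    + E                        ∎
    where open ≤-Reasoning
  exponent : ∃[ q ] ℕ.suc k ≡ 2 ℕ.^ q → ∃[ p ] (1 ℕ.≤ p × r ≡ 2 ℕ.^ p ℕ.+ 1)
  -- A single colour would mean `r = 2`.
  exponent (ℕ.zero  , eq) = contradiction (subst (λ m → 3 ℕ.≤ ℕ.suc m) eq 3≤r) λ { (s≤s (s≤s ())) }
  exponent (ℕ.suc q , eq) = ℕ.suc q , s≤s z≤n , trans (cong ℕ.suc eq) (ℕ.+-comm 1 (2 ℕ.^ ℕ.suc q))

integer-density : ∀ r (3≤r : 3 ℕ.≤ r) c e → densityBound r 3≤r * (+ c / 1) ≤ℚ + e / 1 →
  + (r ∸ 2) ⊗ + (r ℕ.^ 70 ℕ.* 10 ℕ.^ 33) ⊗ + c ≤ᶻ + (r ∸ 1) ⊗ + (r ℕ.^ 70 ℕ.* 10 ℕ.^ 33) ⊗ + e ⊕ + (r ∸ 1) ⊗ + c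
integer-density r 3≤r c e = density-in-integers (r ∸ 2) (r ∸ 1) (r ℕ.^ 70 ℕ.* 10 ℕ.^ 33) c e
  {{ℕ.>-nonZero (ℕ.m<n⇒0<n∸m (ℕ.≤-trans (s≤s (s≤s z≤n)) 3≤r))}}
  {{ℕ.m*n≢0 (r ℕ.^ 70) (10 ℕ.^ 33) {{ℕ.m^n≢0 r 70 {{ℕ.>-nonZero (ℕ.≤-trans (s≤s z≤n) 3≤r)}}}} {{_}}}}


theorem2 : (r : ℕ) (3≤r : 3 ≤ r) →
  ∃[ n₀ ] (∀ (n : ℕ) → n₀ ≤ n → (H : UniformHypergraph 4 n) →
    densityBound r 3≤r * (+ (n C 4) / 1) ≤ℚ + edgeCount H / 1 →
    ¬ CopyOfC⁽⁴⁾ r H →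
    ∃[ p ] (1 ≤ p × r ≡ 2 ^ p + 1))
theorem2 r 3≤r = 6 ℕ.* (r ℕ.^ 70 ℕ.* 10 ℕ.^ 33) , λ n n₀≤n H dense noCopy →
  -- Here `E = r⁷⁰ · 10³³` exceeds `147456 (r - 1)¹²` because `12 ≤ 70` and `147456 < 10³³`; the
  -- threshold on `n` is the `6E` of `dense-tuples`.
  power-of-two-plus-one {n} {147456} r (r ℕ.^ 70 ℕ.* 10 ℕ.^ 33) 3≤r refl
    (power-gap {147456} {10 ℕ.^ 33} {r ∸ 1} {r} {6} {70} {{ℕ.>-nonZero (ℕ.≤-trans (s≤s z≤n) 3≤r)}}
      (ℕ.m∸n≤m r 1) (ℕ.≤ᵇ⇒≤ 12 70 _) (ℕ.<ᵇ⇒< 147456 (10 ℕ.^ 33) _))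
    n₀≤n H (integer-density r 3≤r (n C 4) (edgeCount H) dense) noCopy
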